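{- The Automorphism Conjecture holds for ordered sets of width at most $11$; that is, $$\lim_{n\to\infty}\ \max\left\{ \frac{|\mathrm{Aut}(P)|}{|\mathrm{End}(P)|} : P \text{ a finite ordered set}, |P|=n, w(P)\leq 11\right\} = 0 .$$
   Context: For a finite ordered set $P$, $\mathrm{End}(P)$ is the set of order-preserving self-maps $f:P\to P$ (i.e. $p\leq q$ implies $f(p)\leq f(q)$) and $\mathrm{Aut}(P)$ is the set of automorphisms (order-preserving bijections whose inverse is order-preserving). The width $w(P)$ is the size of a largest antichain of $P$. -}

module Defs where

open import Data.Nat using (ℕ; zero; suc; _≤_)
open import Data.Bool using (Bool; true; false; _∧_; _∨_; not)
open import Data.Fin using (Fin)
open import Data.Fin.Properties using (_≟_)
open import Data.Fin.Subset using (Subset; _∈_; ∣_∣)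
open import Data.Vec using (Vec; []; _∷_; lookup)
open import Data.List using (List; map; concatMap; filterᵇ; length; allFin)
open import Data.Bool.ListAction using (all; any)
import Data.List as L
open import Relation.Nullary using (¬_)
open import Relation.Nullary.Decidable using (⌊_⌋)
open import Relation.Binary.PropositionalEquality using (_≡_)

record FinPoset (n : ℕ) : Set where
  field
    _≼_     : Fin n → Fin n → Bool
    reflex  : ∀ x → (x ≼ x) ≡ true
    antisym : ∀ x y → (x ≼ y) ≡ true → (y ≼ x) ≡ true → x ≡ y
    trans   : ∀ x y z → (x ≼ y) ≡ true → (y ≼ z) ≡ true → (x ≼ z) ≡ true

-- Self-maps of Fin n, represented as tables (vectors) f with f(x) = lookup f x.
SelfMap : ℕ → Set
SelfMap n = Vec (Fin n) n

allVecs : (k n : ℕ) → List (Vec (Fin n) k)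
allVecs zero    n = [] L.∷ L.[]
allVecs (suc k) n = concatMap (λ x → map (x ∷_) (allVecs k n)) (allFin n)

module _ {n : ℕ} (P : FinPoset n) where
  open FinPoset P

  isOrderPreserving : SelfMap n → Bool
  isOrderPreserving f =
    all (λ p → all (λ q → not (p ≼ q) ∨ (lookup f p ≼ lookup f q)) (allFin n)) (allFin n)

  isLeftInverse : SelfMap n → SelfMap n → Bool
  isLeftInverse g f = all (λ p → ⌊ lookup g (lookup f p) ≟ p ⌋) (allFin n)

  isAutomorphism : SelfMap n → Bool
  isAutomorphism f =
    isOrderPreserving f ∧
    any (λ g → isLeftInverse g f ∧ isLeftInverse f g ∧ isOrderPreserving g) (allVecs n n)

  numEnd : ℕ
  numEnd = length (filterᵇ isOrderPreserving (allVecs n n))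

  numAut : ℕ
  numAut = length (filterᵇ isAutomorphism (allVecs n n))

  IsAntichain : Subset n → Set
  IsAntichain S = ∀ x y → x ∈ S → y ∈ S → ¬ (x ≡ y) → (x ≼ y) ≡ false

  WidthAtMost : ℕ → Set
  WidthAtMost k = ∀ (S : Subset n) → IsAntichain S → ∣ S ∣ ≤ k

{-# OPTIONS --safe #-}
-- Let L₀, …, L_H be the levels of the height function, which are antichains, let c₀ < … < c_H be a
-- longest chain, so that c_j ∈ L_j, and let G be the pointwise stabiliser of this chain in Aut P.
--
-- Sending each x ∈ L_j to c_j or c_{j+1} is always order-preserving.  Ask that c_j be hit from L_j
-- (2^|L_j| − 1 ways; both ways are allowed if |L_j| = 1), and let g range over these maps.  The ranks of
-- the values of f ∘ g (f ∈ Aut P) give g back, and then f is known on the chain, so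
-- |Aut P| · ∏ (2^|L_j| − 1) ≤ |End P| · |G|.
--
-- Let T_j, U_j ≤ G fix everything below L_j, respectively everything in or above L_j.  If no two points
-- of L_j have the same relations to all other levels ("twins"), then (f , g) ↦ f ∘ g on L_j ∖ {c_j},
-- for f ∈ T_j and g ∈ U_{j+1}, determines f and g on L_j, whence
-- |T_j| |U_{j+1}| ≤ (|L_j| − 1)! |T_{j+1}| |U_j|.  These telescope to |G|² ≤ ∏ (|L_j| − 1)!, up to a
-- bounded factor for each level with twins and for the top level.  Since 8 (m − 1)! ≤ 7 (2^m − 1)² for
-- 2 ≤ m ≤ 11, |End P| / |Aut P| grows exponentially in H if few levels have twins.
--
-- If many levels have twins, identifying twins on one level and composing with an automorphism gives
-- |Aut P| new endomorphisms for each such level.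
module Submission where

open import Defs
open import Data.Bool using (Bool; true; false; _∧_; _∨_; not; T)
import Data.Bool as Bool
open import Data.Bool.Properties using (T-∧; T-≡; ¬-not)
open import Data.Bool.ListAction using (all)
open import Data.Fin using (Fin)
open import Data.Fin.Properties using (_≟_; any?; all?)
open import Data.Fin.Subset using (Subset; ∣_∣)
import Data.Fin.Subset as Subset
open import Data.Vec using (Vec; []; _∷_; lookup; tabulate)
open import Data.Vec.Properties using (lookup∘tabulate; tabulate∘lookup; tabulate-cong; ≡-dec; []=⇒lookup)
import Data.Vec.Properties as Vec
open import Data.List as List using (List; []; _∷_; _++_; map; concat; concatMap; filter; filterᵇ; length; cartesianProduct; cartesianProductWith; allFin; downFrom; upTo)
open import Data.List.Properties using (length-map; length-++; length-filter; ∷-injective; length-tabulate; length-upTo)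
import Data.List.Properties as List
open import Data.List.Membership.Propositional using (_∈_; _∉_; lose; find)
open import Data.List.Membership.Propositional.Properties
open import Data.List.Relation.Unary.Any using (here; there)
import Data.List.Relation.Unary.Any as Any
import Data.List.Relation.Unary.Any.Properties as Any
open import Data.List.Relation.Unary.All as All using (All; []; _∷_)
import Data.List.Relation.Unary.All.Properties as All
open import Data.List.Relation.Unary.AllPairs using ([]; _∷_)
open import Data.List.Relation.Unary.Unique.Propositional using (Unique)
import Data.List.Relation.Unary.Unique.Propositional.Properties as Unique
open import Data.Product using (∃; ∃-syntax; _×_; _,_; proj₁; proj₂)
import Data.Product.Properties as Product
open import Data.Sum using (_⊎_; inj₁; inj₂)
open import Data.Empty using (⊥-elim)
open import Data.Unit using (⊤; tt)
open import Function using (_∘_; id)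
open import Function.Bundles using (Equivalence)
open import Relation.Nullary using (¬_; Dec; yes; no; ¬?; contradiction; does; _×-dec_; _⊎-dec_; _→-dec_)
open import Relation.Nullary.Decidable using (⌊_⌋; toWitness; fromWitness; from-yes; decidable-stable)
open import Relation.Binary.Definitions using (DecidableEquality)
open import Relation.Binary.PropositionalEquality
open import Data.Nat using (ℕ; zero; suc; pred; _+_; _*_; _∸_; _^_; _!; _≤_; _<_; z≤n; s≤s; >-nonZero; >-nonZero⁻¹)
open import Data.Nat.Properties hiding (_≟_)
import Data.Nat.Properties as ℕ
open import Data.Nat.Tactic.RingSolver using (solve-∀)
open import Data.Integer using (+_)
import Data.Integer as ℤ
import Data.Integer.Properties as ℤ
open import Data.Rational using (ℚ; mkℚ; Positive)
import Data.Rational as ℚ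
import Data.Rational.Properties as ℚ
open import Data.Rational.Unnormalised using (mkℚᵘ; *<*)
import Data.Rational.Unnormalised as ℚᵘ
import Data.Rational.Unnormalised.Properties as ℚᵘ

private
  variable
    A B C : Set

-- Counting with lists

-- The induction deletes one occurrence of `f x` from `ys`; injectivity keeps the images of the
-- remaining entries in what is left.
injection⇒length≤ : (f : A → B) (xs : List A) (ys : List B) → Unique xs →
  (∀ {x} → x ∈ xs → f x ∈ ys) →
  (∀ {x y} → x ∈ xs → y ∈ xs → f x ≡ f y → x ≡ y) →
  length xs ≤ length ys
injection⇒length≤ f [] ys u f∈ inj = z≤n
injection⇒length≤ f (x ∷ xs) ys (x∉ ∷ u) f∈ inj with ∈-∃++ (f∈ (here refl))
... | ys₁ , ys₂ , refl = begin
  suc (length xs)             ≤⟨ s≤s (injection⇒length≤ f xs (ys₁ ++ ys₂) u f∈′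
                                        (λ p q → inj (there p) (there q))) ⟩
  suc (length (ys₁ ++ ys₂))   ≡⟨ cong suc (length-++ ys₁) ⟩
  suc (length ys₁ + length ys₂) ≡⟨ +-suc (length ys₁) (length ys₂) ⟨
  length ys₁ + suc (length ys₂) ≡⟨ length-++ ys₁ ⟨
  length (ys₁ ++ f x ∷ ys₂)   ∎
  where
  open ≤-Reasoning
  f∈′ : ∀ {z} → z ∈ xs → f z ∈ ys₁ ++ ys₂
  f∈′ {z} z∈ with ∈-++⁻ ys₁ (f∈ (there z∈))
  ... | inj₁ p = ∈-++⁺ˡ p
  ... | inj₂ (there p) = ∈-++⁺ʳ ys₁ p
  ... | inj₂ (here eq) = contradiction (inj (here refl) (there z∈) (sym eq)) (All.lookup x∉ z∈)

length-filter-split : ∀ {P : A → Set} (P? : ∀ x → Dec (P x)) xs →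
  length xs ≡ length (filter P? xs) + length (filter (¬? ∘ P?) xs)
length-filter-split P? [] = refl
length-filter-split P? (x ∷ xs) with P? x
... | yes _ = cong suc (length-filter-split P? xs)
... | no _ = trans (cong suc (length-filter-split P? xs)) (sym (+-suc _ _))

module _ (_≟_ : DecidableEquality B) (φ : A → B) where

  -- One fibre is split off for each entry of `ys`. Bounding every duplicate-free list inside a
  -- fibre lets the hypothesis pass to the shrinking remainder of `xs`.
  fibres⇒length≤ : ∀ k (xs : List A) (ys : List B) → Unique xs →
    (∀ {x} → x ∈ xs → φ x ∈ ys) →
    (∀ b zs → Unique zs → (∀ {z} → z ∈ zs → z ∈ xs × φ z ≡ b) → length zs ≤ k) →
    length xs ≤ length ys * k
  fibres⇒length≤ k [] ys u φ∈ fib = z≤n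
  fibres⇒length≤ k (x ∷ xs) [] u φ∈ fib with () ← φ∈ (here refl)
  fibres⇒length≤ k xs@(_ ∷ _) (b ∷ ys) u φ∈ fib = begin
    length xs ≡⟨ length-filter-split P? xs ⟩
    length (filter P? xs) + length xs′
      ≤⟨ +-mono-≤ (fib b _ (Unique.filter⁺ P? u) (∈-filter⁻ P?))
                  (fibres⇒length≤ k xs′ ys (Unique.filter⁺ (¬? ∘ P?) u) φ∈′
                    (λ c zs u′ h → fib c zs u′ λ z∈ →
                      proj₁ (∈-filter⁻ (¬? ∘ P?) (proj₁ (h z∈))) , proj₂ (h z∈))) ⟩
    k + length ys * k ∎
    where
    open ≤-Reasoning
    P? = λ a → φ a ≟ b
    xs′ = filter (¬? ∘ P?) xs
    φ∈′ : ∀ {x} → x ∈ xs′ → φ x ∈ ys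
    φ∈′ {x} x∈ with ∈-filter⁻ (¬? ∘ P?) {xs = xs} x∈
    ... | x∈xs , φx≢b with φ∈ x∈xs
    ... | here eq = contradiction eq φx≢b
    ... | there p = p

  -- In the applications xs is a union of cosets and ψ left translation by the inverse of a₀.
  translates⇒length≤ : (xs : List A) (ys : List B) (zs : List C) → Unique xs →
    (∀ {a} → a ∈ xs → φ a ∈ ys) →
    (∀ {a₀} → a₀ ∈ xs → ∃ λ (ψ : A → C) →
       (∀ {a} → a ∈ xs → φ a ≡ φ a₀ → ψ a ∈ zs) ×
       (∀ {a a′} → a ∈ xs → a′ ∈ xs → φ a ≡ φ a₀ → φ a′ ≡ φ a₀ → ψ a ≡ ψ a′ → a ≡ a′)) →
    length xs ≤ length ys * length zs
  translates⇒length≤ xs ys zs u φ∈ trl = fibres⇒length≤ (length zs) xs ys u φ∈ fib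
    where
    fib : ∀ b ws → Unique ws → (∀ {w} → w ∈ ws → w ∈ xs × φ w ≡ b) → length ws ≤ length zs
    fib b [] _ _ = z≤n
    -- A nonempty fibre supplies its own base point for the translation.
    fib b ws@(a₀ ∷ _) uw h with h (here refl)
    ... | a₀∈ , refl with trl a₀∈
    ... | ψ , ψ∈ , ψ-inj = injection⇒length≤ ψ ws zs uw
            (λ p → ψ∈ (proj₁ (h p)) (proj₂ (h p)))
            (λ p q → ψ-inj (proj₁ (h p)) (proj₁ (h q)) (proj₂ (h p)) (proj₂ (h q)))

length-cartesianProductWith : (f : A → B → C) (xs : List A) (ys : List B) →
  length (cartesianProductWith f xs ys) ≡ length xs * length ys
length-cartesianProductWith f [] ys = refl
length-cartesianProductWith f (x ∷ xs) ys =
  trans (length-++ (map (f x) ys))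
        (cong₂ _+_ (length-map (f x) ys) (length-cartesianProductWith f xs ys))

length-concatMap≤ : ∀ k (f : A → List B) xs → (∀ {x} → x ∈ xs → length (f x) ≤ k) →
  length (concatMap f xs) ≤ length xs * k
length-concatMap≤ k f [] h = z≤n
length-concatMap≤ k f (x ∷ xs) h =
  ≤-trans (≤-reflexive (length-++ (f x)))
          (+-mono-≤ (h (here refl)) (length-concatMap≤ k f xs (h ∘ there)))

!-mono-≤ : ∀ {m n} → m ≤ n → m ! ≤ n !
!-mono-≤ {n = n} z≤n = >-nonZero⁻¹ _ {{n !≢0}}
!-mono-≤ (s≤s m≤n) = *-mono-≤ (s≤s m≤n) (!-mono-≤ m≤n)

map-≡⇒ : ∀ (f g : A → B) xs → map f xs ≡ map g xs → ∀ {x} → x ∈ xs → f x ≡ g x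
map-≡⇒ f g (x ∷ xs) eq (here refl) = proj₁ (∷-injective eq)
map-≡⇒ f g (x ∷ xs) eq (there p) = map-≡⇒ f g xs (proj₂ (∷-injective eq)) p

-- Injective words over a list

module _ (_≟_ : DecidableEquality A) where

  without : A → List A → List A
  without a = filter (λ x → ¬? (x ≟ a))

  length-without : ∀ {a} xs → a ∈ xs → length (without a xs) < length xs
  length-without {a} (x ∷ xs) p with x ≟ a | p
  ... | yes _ | _ = s≤s (length-filter _ xs)
  ... | no x≢a | here eq = contradiction (sym eq) x≢a
  ... | no _ | there p = s≤s (length-without xs p)

  -- These serve as codes for the permutations that automorphisms induce on a level without its
  -- chain element.
  arrangements : ℕ → List A → List (List A)
  arrangements zero xs = [] ∷ []
  arrangements (suc k) xs = concatMap (λ a → map (a ∷_) (arrangements k (without a xs))) xs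

  length-arrangements : ∀ k xs → length xs ≤ k → length (arrangements k xs) ≤ k !
  length-arrangements zero xs le = s≤s z≤n
  length-arrangements (suc k) xs le = ≤-trans
    (length-concatMap≤ (k !) _ xs λ {a} a∈ →
      ≤-trans (≤-reflexive (length-map (a ∷_) (arrangements k (without a xs))))
              (length-arrangements k _ (≤-pred (≤-trans (length-without xs a∈) le))))
    (*-monoˡ-≤ (k !) le)

  ∈-arrangements : ∀ l xs → Unique l → (∀ {x} → x ∈ l → x ∈ xs) → l ∈ arrangements (length l) xs
  ∈-arrangements [] xs u h = here refl
  ∈-arrangements (a ∷ l) xs (a∉ ∷ u) h =
    ∈-concatMap⁺ _ (lose (h (here refl)) (∈-map⁺ (a ∷_)
      (∈-arrangements l _ u λ x∈ →
        ∈-filter⁺ _ (h (there x∈)) λ { refl → All.lookup a∉ x∈ refl })))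

-- Nonempty sublists

sublists⁺ : List A → List (List A)
sublists⁺ [] = []
sublists⁺ (x ∷ xs) = (x ∷ []) ∷ map (x ∷_) (sublists⁺ xs) ++ sublists⁺ xs

∈-sublists⁺⇒⊆ : ∀ (xs : List A) {l} → l ∈ sublists⁺ xs → ∀ {a} → a ∈ l → a ∈ xs
∈-sublists⁺⇒⊆ (x ∷ xs) (here refl) (here refl) = here refl
∈-sublists⁺⇒⊆ (x ∷ xs) (there p) a∈ with ∈-++⁻ (map (x ∷_) (sublists⁺ xs)) p
... | inj₂ q = there (∈-sublists⁺⇒⊆ xs q a∈)
... | inj₁ q with ∈-map⁻ (x ∷_) q
∈-sublists⁺⇒⊆ (x ∷ xs) (there p) (here refl) | inj₁ q | l , l∈ , refl = here refl
∈-sublists⁺⇒⊆ (x ∷ xs) (there p) (there a∈) | inj₁ q | l , l∈ , refl =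
  there (∈-sublists⁺⇒⊆ xs l∈ a∈)

sublists⁺-nonempty : ∀ (xs : List A) {l} → l ∈ sublists⁺ xs → ∃ (_∈ l)
sublists⁺-nonempty (x ∷ xs) (here refl) = x , here refl
sublists⁺-nonempty (x ∷ xs) (there p) with ∈-++⁻ (map (x ∷_) (sublists⁺ xs)) p
... | inj₂ q = sublists⁺-nonempty xs q
... | inj₁ q with ∈-map⁻ (x ∷_) q
... | l , l∈ , refl = x , here refl

-- Every sublist keeps the order of `xs`, so it is a canonical list for its set of entries. This
-- recovers a choice of subsets from the map built on it.
sublists⁺-ext : ∀ (xs : List A) → Unique xs → ∀ {l m} → l ∈ sublists⁺ xs → m ∈ sublists⁺ xs →
  (∀ {a} → a ∈ l → a ∈ m) → (∀ {a} → a ∈ m → a ∈ l) → l ≡ m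
sublists⁺-ext [] _ () _ _ _
sublists⁺-ext {A = A} (x ∷ xs) (x∉ ∷ u) {l} {m} p q l⊆m m⊆l = go (shape p) (shape q) l⊆m m⊆l
  where
  Shape : List A → Set
  Shape l = (∃ λ l′ → l ≡ x ∷ l′ × (l′ ≡ [] ⊎ l′ ∈ sublists⁺ xs)) ⊎ l ∈ sublists⁺ xs
  shape : ∀ {l} → l ∈ sublists⁺ (x ∷ xs) → Shape l
  shape (here refl) = inj₁ ([] , refl , inj₁ refl)
  shape (there p) with ∈-++⁻ (map (x ∷_) (sublists⁺ xs)) p
  ... | inj₂ q = inj₂ q
  ... | inj₁ q with ∈-map⁻ (x ∷_) q
  ... | l , l∈ , refl = inj₁ (l , refl , inj₂ l∈)
  x∉sub : ∀ {l} → l ∈ sublists⁺ xs → x ∉ l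
  x∉sub l∈ x∈ = All.lookup x∉ (∈-sublists⁺⇒⊆ xs l∈ x∈) refl
  strip : ∀ {l m} → l ∈ sublists⁺ xs → (∀ {a} → a ∈ l → a ∈ x ∷ m) → ∀ {a} → a ∈ l → a ∈ m
  strip l∈ h a∈ with h a∈
  ... | here refl = ⊥-elim (x∉sub l∈ a∈)
  ... | there b = b
  go : ∀ {l m} → Shape l → Shape m → (∀ {a} → a ∈ l → a ∈ m) → (∀ {a} → a ∈ m → a ∈ l) → l ≡ m
  go (inj₂ l∈) (inj₂ m∈) f g = sublists⁺-ext xs u l∈ m∈ f g
  go (inj₁ (_ , refl , _)) (inj₂ m∈) f g = ⊥-elim (x∉sub m∈ (f (here refl)))
  go (inj₂ l∈) (inj₁ (_ , refl , _)) f g = ⊥-elim (x∉sub l∈ (g (here refl)))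
  go (inj₁ (_ , refl , inj₁ refl)) (inj₁ (_ , refl , inj₁ refl)) f g = refl
  go (inj₁ (_ , refl , inj₂ l∈)) (inj₁ (_ , refl , inj₁ refl)) f g
    with sublists⁺-nonempty xs l∈
  ... | a , a∈ with strip {m = []} l∈ (f ∘ there) a∈
  ... | ()
  go (inj₁ (_ , refl , inj₁ refl)) (inj₁ (_ , refl , inj₂ m∈)) f g
    with sublists⁺-nonempty xs m∈
  ... | a , a∈ with strip {m = []} m∈ (g ∘ there) a∈
  ... | ()
  go (inj₁ (_ , refl , inj₂ l∈)) (inj₁ (_ , refl , inj₂ m∈)) f g =
    cong (x ∷_) (sublists⁺-ext xs u l∈ m∈ (strip l∈ (f ∘ there)) (strip m∈ (g ∘ there)))

sublists⁺-unique : ∀ (xs : List A) → Unique xs → Unique (sublists⁺ xs)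
sublists⁺-unique [] _ = []
sublists⁺-unique (x ∷ xs) (x∉ ∷ u) =
  All.tabulate x∷[]-fresh ∷
  Unique.++⁺ (Unique.map⁺ (proj₂ ∘ ∷-injective) (sublists⁺-unique xs u)) (sublists⁺-unique xs u)
    λ { (p , q) → disj p q }
  where
  x∉sub : ∀ {l} → l ∈ sublists⁺ xs → x ∉ l
  x∉sub l∈ x∈ = All.lookup x∉ (∈-sublists⁺⇒⊆ xs l∈ x∈) refl
  disj : ∀ {l} → l ∈ map (x ∷_) (sublists⁺ xs) → l ∉ sublists⁺ xs
  disj p q with ∈-map⁻ (x ∷_) p
  ... | l , l∈ , refl = x∉sub q (here refl)
  x∷[]-fresh : ∀ {l} → l ∈ map (x ∷_) (sublists⁺ xs) ++ sublists⁺ xs → x ∷ [] ≢ l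
  x∷[]-fresh p eq with ∈-++⁻ (map (x ∷_) (sublists⁺ xs)) p
  x∷[]-fresh p refl | inj₂ q = x∉sub q (here refl)
  ... | inj₁ q with ∈-map⁻ (x ∷_) q
  x∷[]-fresh p refl | inj₁ q | [] , l∈ , refl with () ← proj₂ (sublists⁺-nonempty xs l∈)

length-sublists⁺ : ∀ (xs : List A) → suc (length (sublists⁺ xs)) ≡ 2 ^ length xs
length-sublists⁺ [] = refl
length-sublists⁺ (x ∷ xs) = trans
  (cong (suc ∘ suc) (trans (length-++ (map (x ∷_) (sublists⁺ xs)))
    (cong (_+ length (sublists⁺ xs)) (length-map (x ∷_) (sublists⁺ xs)))))
  (trans (cong suc (sym (+-suc (length (sublists⁺ xs)) _)))
    (cong₂ _+_ (length-sublists⁺ xs) (trans (length-sublists⁺ xs) (sym (+-identityʳ _)))))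

-- Subsets of a level: the points sent to the chain element of that level

levelOptions : A → List A → List (List A)
levelOptions c []       = [] ∷ (c ∷ []) ∷ []
levelOptions c (x ∷ xs) = sublists⁺ (c ∷ x ∷ xs)

-- Here `q` counts the points of the level beside its chain element. For q = 0 the nonempty subsets
-- alone would number 1, and 8 * 0! ≤ 7 * 1² fails; the second option for one-point levels repairs
-- this.
optionCount : ℕ → ℕ
optionCount zero    = 2
optionCount (suc q) = pred (2 ^ (2 + q))

length-levelOptions : ∀ (c : A) xs → length (levelOptions c xs) ≡ optionCount (length xs)
length-levelOptions c []       = refl
length-levelOptions c (x ∷ xs) = cong pred (length-sublists⁺ (c ∷ x ∷ xs))

levelOptions-unique : ∀ (c : A) xs → Unique (c ∷ xs) → Unique (levelOptions c xs)
levelOptions-unique c []       u = ((λ ()) ∷ []) ∷ [] ∷ []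
levelOptions-unique c (x ∷ xs) u = sublists⁺-unique _ u

levelOptions-⊆ : ∀ (c : A) xs {l} → l ∈ levelOptions c xs → ∀ {a} → a ∈ l → a ∈ c ∷ xs
levelOptions-⊆ c []       (here refl) ()
levelOptions-⊆ c []       (there (here refl)) a∈ = a∈
levelOptions-⊆ c (x ∷ xs) l∈ a∈ = ∈-sublists⁺⇒⊆ (c ∷ x ∷ xs) l∈ a∈

levelOptions-ext : ∀ (c : A) xs → Unique (c ∷ xs) → ∀ {l m} →
  l ∈ levelOptions c xs → m ∈ levelOptions c xs →
  (∀ {a} → a ∈ l → a ∈ m) → (∀ {a} → a ∈ m → a ∈ l) → l ≡ m
levelOptions-ext c [] u (here refl) (here refl) f g = refl
levelOptions-ext c [] u (here refl) (there (here refl)) f g with () ← g (here refl)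
levelOptions-ext c [] u (there (here refl)) (here refl) f g with () ← f (here refl)
levelOptions-ext c [] u (there (here refl)) (there (here refl)) f g = refl
levelOptions-ext c (x ∷ xs) u = sublists⁺-ext _ u

-- The second alternative does no harm: automorphisms preserve the levels, so they fix the point of
-- a one-point level whether it is hit or not.
levelOptions-inhabited : ∀ (c : A) xs {l} → l ∈ levelOptions c xs → ∃ (_∈ l) ⊎ xs ≡ []
levelOptions-inhabited c []       l∈ = inj₂ refl
levelOptions-inhabited c (x ∷ xs) l∈ = inj₁ (sublists⁺-nonempty (c ∷ x ∷ xs) l∈)

-- Width 11 is the limit of the method: 10! < 4¹¹, but 11! > 4¹².
8q!≤7optionCount² : ∀ {q} → q ≤ 10 → 8 * q ! ≤ 7 * (optionCount q * optionCount q)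
8q!≤7optionCount² q≤10 =
  from-yes (allUpTo? (λ q → 8 * q ! ≤? 7 * (optionCount q * optionCount q)) 11) (s≤s q≤10)

-- Tables of maps, their enumeration, and bounded search

lookup-ext : ∀ {k} {f g : Vec A k} → (∀ x → lookup f x ≡ lookup g x) → f ≡ g
lookup-ext {f = f} {g} h =
  trans (sym (tabulate∘lookup f)) (trans (tabulate-cong h) (tabulate∘lookup g))

tabulate-≡⇒ : ∀ {k} {f g : Fin k → A} → tabulate f ≡ tabulate g → ∀ x → f x ≡ g x
tabulate-≡⇒ {f = f} {g} eq x =
  trans (sym (lookup∘tabulate f x)) (trans (cong (λ v → lookup v x) eq) (lookup∘tabulate g x))

concatMap-map : ∀ (f : A → B → C) xs ys →
  concatMap (λ x → map (f x) ys) xs ≡ cartesianProductWith f xs ys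
concatMap-map f []       ys = refl
concatMap-map f (x ∷ xs) ys = cong (map (f x) ys ++_) (concatMap-map f xs ys)

∈-allVecs : ∀ {k n} (v : Vec (Fin n) k) → v ∈ allVecs k n
∈-allVecs [] = here refl
∈-allVecs {suc k} {n} (x ∷ v) =
  subst (x ∷ v ∈_) (sym (concatMap-map _∷_ (allFin n) (allVecs k n)))
    (∈-cartesianProductWith⁺ _∷_ (∈-allFin x) (∈-allVecs v))

allVecs-unique : ∀ k n → Unique (allVecs k n)
allVecs-unique zero    n = [] ∷ []
allVecs-unique (suc k) n =
  subst Unique (sym (concatMap-map _∷_ (allFin n) (allVecs k n)))
    (Unique.cartesianProductWith⁺ _∷_ Vec.∷-injective (Unique.allFin⁺ n) (allVecs-unique k n))

-- The search descends from `m` and stops at the first `k` with `D k`; `D (suc k)` was refuted just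
-- before. It yields both the rank of a point and the length of a longest chain.
boundedMaximum : ∀ {D : ℕ → Set} → (∀ k → Dec (D k)) → D 0 → ∀ m → ¬ D m → ∃ λ k → D k × ¬ D (suc k)
boundedMaximum D? d₀ zero    ¬d = contradiction d₀ ¬d
boundedMaximum D? d₀ (suc m) ¬d with D? m
... | yes d = m , d , ¬d
... | no ¬d′ = boundedMaximum D? d₀ m ¬d′

-- Connects counting by lists with the cardinality of a `Subset`, in which `WidthAtMost` is
-- expressed.
length-filter-tabulate : ∀ {n} {P : A → Set} (P? : ∀ x → Dec (P x)) (f : Fin n → A) →
  length (filter P? (List.tabulate f)) ≡ ∣ tabulate (λ i → does (P? (f i))) ∣
length-filter-tabulate {n = zero}  P? f = refl
length-filter-tabulate {n = suc n} P? f with does (P? (f Fin.zero))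
... | true  = cong suc (length-filter-tabulate P? (f ∘ Fin.suc))
... | false = length-filter-tabulate P? (f ∘ Fin.suc)

T-all⁺ : ∀ {n} (p : Fin n → Bool) → (∀ x → T (p x)) → T (all p (allFin n))
T-all⁺ {n} p h = All.all⁻ p (All.universal h (allFin n))

T-all⁻ : ∀ {n} (p : Fin n → Bool) → T (all p (allFin n)) → ∀ x → T (p x)
T-all⁻ {n} p t x = All.lookup (All.all⁺ p (allFin n) t) (∈-allFin x)

-- Order-preserving maps and automorphisms

module Poset {n : ℕ} (P : FinPoset n) where
  open FinPoset P renaming (trans to ≼-trans)

  infix 4 _⊑_ _≺_
  _⊑_ _≺_ : Fin n → Fin n → Set
  x ⊑ y = (x ≼ y) ≡ true
  x ≺ y = x ⊑ y × x ≢ y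

  ⊑-refl : ∀ {x} → x ⊑ x
  ⊑-refl = reflex _

  ⊑-trans : ∀ {x y z} → x ⊑ y → y ⊑ z → x ⊑ z
  ⊑-trans = ≼-trans _ _ _

  _⊑?_ : ∀ x y → Dec (x ⊑ y)
  x ⊑? y = (x ≼ y) Bool.≟ true

  _≺?_ : ∀ x y → Dec (x ≺ y)
  x ≺? y = (x ⊑? y) ×-dec ¬? (x ≟ y)

  _∈?_ : ∀ x (xs : List (Fin n)) → Dec (x ∈ xs)
  x ∈? xs = Any.any? (x ≟_) xs

  Monotone : (Fin n → Fin n) → Set
  Monotone f = ∀ {x y} → x ⊑ y → f x ⊑ f y

  monotone⇒T : ∀ f → Monotone (lookup f) → T (isOrderPreserving P f)
  monotone⇒T f m = T-all⁺ (λ p → all (preserved p) (allFin n)) (λ p → T-all⁺ (preserved p) (go p))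
    where
    preserved : Fin n → Fin n → Bool
    preserved p q = not (p ≼ q) ∨ (lookup f p ≼ lookup f q)
    go : ∀ p q → T (preserved p q)
    go p q with p ≼ q in eq
    ... | false = tt
    ... | true  = Equivalence.from T-≡ (m eq)

  T⇒monotone : ∀ f → T (isOrderPreserving P f) → Monotone (lookup f)
  T⇒monotone f t {x} {y} x⊑y
    with T-all⁻ (preserved x) (T-all⁻ (λ p → all (preserved p) (allFin n)) t x) y
    where
    preserved : Fin n → Fin n → Bool
    preserved p q = not (p ≼ q) ∨ (lookup f p ≼ lookup f q)
  ... | r rewrite x⊑y = Equivalence.to T-≡ r

  T⇒leftInverse : ∀ g f → T (isLeftInverse P g f) → ∀ x → lookup g (lookup f x) ≡ x
  T⇒leftInverse g f t x = toWitness (T-all⁻ (λ p → ⌊ lookup g (lookup f p) ≟ p ⌋) t x)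

  leftInverse⇒T : ∀ g f → (∀ x → lookup g (lookup f x) ≡ x) → T (isLeftInverse P g f)
  leftInverse⇒T g f h = T-all⁺ (λ p → ⌊ lookup g (lookup f p) ≟ p ⌋) (λ x → fromWitness (h x))

  record Automorphism (f : SelfMap n) : Set where
    field
      monotone         : Monotone (lookup f)
      inverse          : SelfMap n
      inverse-monotone : Monotone (lookup inverse)
      inverseˡ         : ∀ x → lookup inverse (lookup f x) ≡ x
      inverseʳ         : ∀ x → lookup f (lookup inverse x) ≡ x

    injective : ∀ {x y} → lookup f x ≡ lookup f y → x ≡ y
    injective {x} {y} eq = trans (sym (inverseˡ x)) (trans (cong (lookup inverse) eq) (inverseˡ y))

  open Automorphism

  isInverse : SelfMap n → SelfMap n → Bool
  isInverse f g = isLeftInverse P g f ∧ isLeftInverse P f g ∧ isOrderPreserving P g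

  automorphism⇒T : ∀ {f} → Automorphism f → T (isAutomorphism P f)
  automorphism⇒T {f} a = Equivalence.from T-∧
    (monotone⇒T f (monotone a) ,
     Any.any⁺ (isInverse f) (lose (∈-allVecs g) (Equivalence.from (T-∧ {isLeftInverse P g f})
       (leftInverse⇒T g f (inverseˡ a) , Equivalence.from (T-∧ {isLeftInverse P f g})
       (leftInverse⇒T f g (inverseʳ a) , monotone⇒T g (inverse-monotone a))))))
    where
    g : SelfMap n
    g = inverse a

  T⇒automorphism : ∀ {f} → T (isAutomorphism P f) → Automorphism f
  T⇒automorphism {f} t with Equivalence.to T-∧ t
  ... | m , ex with find (Any.any⁻ (isInverse f) (allVecs n n) ex)
  ... | g , _ , t₁ with Equivalence.to (T-∧ {isLeftInverse P g f}) t₁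
  ... | l , t₂ with Equivalence.to (T-∧ {isLeftInverse P f g}) t₂
  ... | r , m′ = record
    { monotone = T⇒monotone f m ; inverse = g ; inverse-monotone = T⇒monotone g m′
    ; inverseˡ = T⇒leftInverse g f l ; inverseʳ = T⇒leftInverse f g r }

  -- From here on the two lists are used only through the facts of this block.
  abstract
    ends auts : List (SelfMap n)
    ends = filterᵇ (isOrderPreserving P) (allVecs n n)
    auts = filterᵇ (isAutomorphism P) (allVecs n n)

    auts-unique : Unique auts
    auts-unique = Unique.filter⁺ _ (allVecs-unique n n)

    tabulate∈ends : ∀ {f} → Monotone f → tabulate f ∈ ends
    tabulate∈ends {f} m = ∈-filter⁺ _ (∈-allVecs (tabulate f)) (monotone⇒T (tabulate f) λ {x} {y} x⊑y →
      subst₂ _⊑_ (sym (lookup∘tabulate f x)) (sym (lookup∘tabulate f y)) (m x⊑y))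

    ∈auts⁺ : ∀ {f} → Automorphism f → f ∈ auts
    ∈auts⁺ {f} a = ∈-filter⁺ _ (∈-allVecs f) (automorphism⇒T a)

    ∈auts⁻ : ∀ {f} → f ∈ auts → Automorphism f
    ∈auts⁻ {f} f∈ = T⇒automorphism (proj₂ (∈-filter⁻ _ {xs = allVecs n n} f∈))

    numEnd≡length-ends : numEnd P ≡ length ends
    numEnd≡length-ends = refl

    numAut≡length-auts : numAut P ≡ length auts
    numAut≡length-auts = refl

  idTable : SelfMap n
  idTable = tabulate id

  id-automorphism : Automorphism idTable
  id-automorphism = record
    { monotone = m ; inverse = idTable ; inverse-monotone = m ; inverseˡ = i ; inverseʳ = i }
    where
    m : Monotone (lookup idTable)
    m {x} {y} le = subst₂ _⊑_ (sym (lookup∘tabulate id x)) (sym (lookup∘tabulate id y)) le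
    i : ∀ x → lookup idTable (lookup idTable x) ≡ x
    i x = trans (lookup∘tabulate id _) (lookup∘tabulate id x)

  -- Left translation by the inverse of `f`: where `f` and `g` agree, the result fixes every point.
  -- This maps a fibre of automorphisms into a stabiliser.
  quotient : ∀ {f} → Automorphism f → SelfMap n → SelfMap n
  quotient a g = tabulate (λ x → lookup (inverse a) (lookup g x))

  lookup-quotient : ∀ {f} (a : Automorphism f) g x →
    lookup (quotient a g) x ≡ lookup (inverse a) (lookup g x)
  lookup-quotient a g x = lookup∘tabulate _ x

  quotient-automorphism : ∀ {f g} (a : Automorphism f) → Automorphism g → Automorphism (quotient a g)
  quotient-automorphism {f} {g} a b = record
    { monotone = λ {x} {y} le → subst₂ _⊑_ (sym (lookup-quotient a g x)) (sym (lookup-quotient a g y))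
                   (inverse-monotone a (monotone b le))
    ; inverse = tabulate inv
    ; inverse-monotone = λ {x} {y} le → subst₂ _⊑_ (sym (lookup∘tabulate inv x)) (sym (lookup∘tabulate inv y))
                   (inverse-monotone b (monotone a le))
    ; inverseˡ = λ x → trans (lookup∘tabulate inv _) (trans (cong (λ z → lookup (inverse b) (lookup f z))
                   (lookup-quotient a g x))
                   (trans (cong (lookup (inverse b)) (inverseʳ a _)) (inverseˡ b x)))
    ; inverseʳ = λ x → trans (lookup-quotient a g _) (trans (cong (λ z → lookup (inverse a) (lookup g z))
                   (lookup∘tabulate inv x))
                   (trans (cong (lookup (inverse a)) (inverseʳ b _)) (inverseˡ a x)))
    }
    where
    inv : Fin n → Fin n
    inv x = lookup (inverse b) (lookup f x)

  quotient-fixes : ∀ {f} (a : Automorphism f) {g x} → lookup g x ≡ lookup f x →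
    lookup (quotient a g) x ≡ x
  quotient-fixes {f} a {g} {x} eq =
    trans (lookup-quotient a g x) (trans (cong (lookup (inverse a)) eq) (inverseˡ a x))

  quotient-injective : ∀ {f} (a : Automorphism f) {g g′} → quotient a g ≡ quotient a g′ → g ≡ g′
  quotient-injective {f} a {g} {g′} eq = lookup-ext λ x →
    trans (sym (inverseʳ a _)) (trans (cong (lookup f) (tabulate-≡⇒ eq x)) (inverseʳ a _))

  automorphism-reflects : ∀ {f} → Automorphism f → ∀ {x y} → lookup f x ⊑ lookup f y → x ⊑ y
  automorphism-reflects a {x} {y} le =
    subst₂ _⊑_ (inverseˡ a x) (inverseˡ a y) (inverse-monotone a le)

  automorphism-≼ : ∀ {f} → Automorphism f → ∀ x y → (lookup f x ≼ lookup f y) ≡ (x ≼ y)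
  automorphism-≼ {f} a x y with x ≼ y in eq | lookup f x ≼ lookup f y in eq′
  ... | true  | true  = refl
  ... | false | false = refl
  ... | true  | false = trans (sym eq′) (monotone a eq)
  ... | false | true  = trans (sym (automorphism-reflects a eq′)) eq

  antichain⇒length≤ : ∀ {w} → WidthAtMost P w → ∀ zs → Unique zs →
    (∀ {x y} → x ∈ zs → y ∈ zs → x ≢ y → ¬ (x ⊑ y)) → length zs ≤ w
  antichain⇒length≤ {w} width zs u anti = begin
    length zs ≤⟨ injection⇒length≤ id zs (filter (_∈? zs) (allFin n)) u
                   (λ {x} x∈ → ∈-filter⁺ (_∈? zs) (∈-allFin x) x∈) (λ _ _ eq → eq) ⟩
    length (filter (_∈? zs) (allFin n)) ≡⟨ length-filter-tabulate (_∈? zs) id ⟩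
    ∣ S ∣ ≤⟨ width S (λ x y x∈ y∈ x≢y → ¬-not (anti (S⊆zs x∈) (S⊆zs y∈) x≢y)) ⟩
    w ∎
    where
    open ≤-Reasoning
    S : Subset n
    S = tabulate (λ i → does (i ∈? zs))
    S⊆zs : ∀ {x} → x Subset.∈ S → x ∈ zs
    S⊆zs {x} x∈ with x ∈? zs | trans (sym (lookup∘tabulate (λ i → does (i ∈? zs)) x)) ([]=⇒lookup x∈)
    ... | yes p | _ = p

  -- The height function

  -- Height at least `k`, witnessed by `k` strict steps down from `x`. This form is decidable by
  -- recursion, and the height is the last `k` for which it holds.
  HasHeight : ℕ → Fin n → Set
  HasHeight zero    x = ⊤
  HasHeight (suc k) x = ∃ λ y → y ≺ x × HasHeight k y

  hasHeight? : ∀ k x → Dec (HasHeight k x)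
  hasHeight? zero    x = yes tt
  hasHeight? (suc k) x = any? (λ y → (y ≺? x) ×-dec hasHeight? k y)

  hasHeight-pred : ∀ k {x} → HasHeight (suc k) x → HasHeight k x
  hasHeight-pred zero    _ = tt
  hasHeight-pred (suc k) (y , y≺x , h) = y , y≺x , hasHeight-pred k h

  hasHeight-≤ : ∀ {k m x} → k ≤ m → HasHeight m x → HasHeight k x
  hasHeight-≤ {k} {m} k≤m h with m≤n⇒m<n∨m≡n k≤m
  ... | inj₂ refl = h
  hasHeight-≤ {k} {suc m} _ h | inj₁ (s≤s k≤m) = hasHeight-≤ k≤m (hasHeight-pred m h)

  -- By antisymmetry the points of a strict descent are distinct, so heights stay below `n`; this
  -- bounds the search for `rank`.
  hasHeight⇒chain : ∀ k {x} → HasHeight k x →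
    ∃ λ l → Unique l × length l ≡ suc k × (∀ {z} → z ∈ l → z ⊑ x)
  hasHeight⇒chain zero {x} _ = x ∷ [] , [] ∷ [] , refl , λ { (here refl) → ⊑-refl }
  hasHeight⇒chain (suc k) {x} (y , (y⊑x , y≢x) , h) with hasHeight⇒chain k h
  ... | l , u , len , l⊑y = x ∷ l
      , All.tabulate (λ { {z} z∈ refl → y≢x (antisym y x y⊑x (l⊑y z∈)) }) ∷ u
      , cong suc len
      , λ { (here refl) → ⊑-refl ; (there z∈) → ⊑-trans (l⊑y z∈) y⊑x }

  ¬hasHeight-n : ∀ {x} → ¬ HasHeight n x
  ¬hasHeight-n h with hasHeight⇒chain n h
  ... | l , u , len , _ = 1+n≰n (subst₂ _≤_ len (length-tabulate {n = n} id)
    (injection⇒length≤ id l (allFin n) u (λ _ → ∈-allFin _) (λ _ _ eq → eq)))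

  abstract
    rank-spec : ∀ x → ∃ λ k → HasHeight k x × ¬ HasHeight (suc k) x
    rank-spec x = boundedMaximum (λ k → hasHeight? k x) tt n ¬hasHeight-n

    rank : Fin n → ℕ
    rank x = proj₁ (rank-spec x)

    hasHeight-rank : ∀ x → HasHeight (rank x) x
    hasHeight-rank x = proj₁ (proj₂ (rank-spec x))

    hasHeight⇒≤rank : ∀ {k x} → HasHeight k x → k ≤ rank x
    hasHeight⇒≤rank {k} {x} h with k ≤? rank x
    ... | yes p = p
    ... | no ¬p = contradiction (hasHeight-≤ (≰⇒> ¬p) h) (proj₂ (proj₂ (rank-spec x)))

  ≺⇒rank< : ∀ {x y} → x ≺ y → rank x < rank y
  ≺⇒rank< {x} x≺y = hasHeight⇒≤rank (x , x≺y , hasHeight-rank x)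

  sameRank⇒¬⊑ : ∀ {x y} → rank x ≡ rank y → x ≢ y → ¬ (x ⊑ y)
  sameRank⇒¬⊑ eq x≢y x⊑y = <-irrefl eq (≺⇒rank< (x⊑y , x≢y))

  hasHeight-automorphism : ∀ {f} → Automorphism f → ∀ k {x} → HasHeight k x → HasHeight k (lookup f x)
  hasHeight-automorphism a zero _ = tt
  hasHeight-automorphism {f} a (suc k) (y , (y⊑x , y≢x) , h) =
    lookup f y , (monotone a y⊑x , y≢x ∘ injective a) , hasHeight-automorphism a k h

  inverse-automorphism : ∀ {f} (a : Automorphism f) → Automorphism (inverse a)
  inverse-automorphism {f} a = record
    { monotone = inverse-monotone a ; inverse = f ; inverse-monotone = monotone a
    ; inverseˡ = inverseʳ a ; inverseʳ = inverseˡ a }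

  -- Automorphisms carry strict descents to strict descents; applied to the inverse, this gives the
  -- other inequality.
  rank-automorphism : ∀ {f} → Automorphism f → ∀ x → rank (lookup f x) ≡ rank x
  rank-automorphism {f} a x = ≤-antisym
    (hasHeight⇒≤rank (subst (HasHeight _) (inverseˡ a x)
      (hasHeight-automorphism (inverse-automorphism a) _ (hasHeight-rank (lookup f x)))))
    (hasHeight⇒≤rank (hasHeight-automorphism a _ (hasHeight-rank x)))

  -- The first step of a longest descent from `x` reaches a point whose height is exactly one less.
  -- At rank 0 the point is `x` itself, in agreement with `pred 0`.
  descend : ∀ x → ∃ λ y → y ⊑ x × rank y ≡ pred (rank x)
  descend x = go (rank x) refl (hasHeight-rank x)
    where
    go : ∀ k → rank x ≡ k → HasHeight k x → ∃ λ y → y ⊑ x × rank y ≡ pred k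
    go zero    eq h = x , ⊑-refl , eq
    go (suc k) eq (y , y≺x , h) = y , proj₁ y≺x ,
      ≤-antisym (≤-pred (subst (rank y <_) eq (≺⇒rank< y≺x))) (hasHeight⇒≤rank h)

  -- Twins

  -- Points below `x` have smaller rank and points above it larger rank, so the two conditions cover
  -- all relations to the other levels.
  TwinPair : ℕ → Fin n → Fin n → Set
  TwinPair j x y = (rank x ≡ j × rank y ≡ j × x ≢ y) ×
    (∀ z → rank z < j → (z ≼ x) ≡ (z ≼ y)) × (∀ z → j < rank z → (x ≼ z) ≡ (y ≼ z))

  TwinLevel : ℕ → Set
  TwinLevel j = ∃ λ x → ∃ λ y → TwinPair j x y

  twinLevel? : ∀ j → Dec (TwinLevel j)
  twinLevel? j = any? λ x → any? λ y →
    ((rank x ℕ.≟ j) ×-dec (rank y ℕ.≟ j) ×-dec ¬? (x ≟ y)) ×-dec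
    all? (λ z → (rank z <? j) →-dec ((z ≼ x) Bool.≟ (z ≼ y))) ×-dec
    all? (λ z → (j <? rank z) →-dec ((x ≼ z) Bool.≟ (y ≼ z)))

  identify : Fin n → Fin n → Fin n → Fin n
  identify x y z with z ≟ x
  ... | yes _ = y
  ... | no _  = z

  identify-self : ∀ x y → identify x y x ≡ y
  identify-self x y with x ≟ x
  ... | yes _ = refl
  ... | no x≢x = contradiction refl x≢x

  identify-other : ∀ x y {z} → z ≢ x → identify x y z ≡ z
  identify-other x y {z} z≢x with z ≟ x
  ... | yes z≡x = contradiction z≡x z≢x
  ... | no _ = refl

  -- A strict comparison involving `x` leads to another level, and to that level `y` is related as
  -- `x` is.
  identify-monotone : ∀ {j x y} → TwinPair j x y → Monotone (identify x y)
  identify-monotone {j} {x} {y} ((rx , ry , x≢y) , down , up) {z} {w} z⊑w with z ≟ x | w ≟ x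
  ... | yes _    | yes _   = ⊑-refl
  ... | yes refl | no w≢x  = trans (sym (up w (subst (_< rank w) rx (≺⇒rank< (z⊑w , w≢x ∘ sym))))) z⊑w
  ... | no z≢x   | yes refl = trans (sym (down z (subst (rank z <_) rx (≺⇒rank< (z⊑w , z≢x))))) z⊑w
  ... | no _     | no _    = z⊑w

  twinLevels : ℕ → List ℕ
  twinLevels h = filter twinLevel? (downFrom h)

  -- The pair of twins is the one that `twinLevel?` returns, so the map depends on `j` alone; `id`
  -- is a default for levels without twins.
  fold : ℕ → Fin n → Fin n
  fold j with twinLevel? j
  ... | yes (x , y , _) = identify x y
  ... | no _ = id

  fold-twin : ∀ {j} → TwinLevel j → ∃ λ x → ∃ λ y → TwinPair j x y × (∀ z → fold j z ≡ identify x y z)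
  fold-twin {j} t with twinLevel? j
  ... | yes (x , y , p) = x , y , p , λ _ → refl
  ... | no ¬t = contradiction t ¬t

  -- The level is visible in the composite: `f` after `identify x y` merges two points of level `j`,
  -- whereas `g` after `identify u v` is injective on every level other than `i`.
  identify-level : ∀ {f g j i x y u v} → Automorphism g → TwinPair j x y → TwinPair i u v →
    (∀ z → lookup f (identify x y z) ≡ lookup g (identify u v z)) → j ≡ i
  identify-level {f} {g} {j} {i} {x} {y} {u} {v} b ((rx , ry , x≢y) , _) ((ru , _) , _) eq =
    decidable-stable (j ℕ.≟ i) λ j≢i →
      let to-g : ∀ {z} → rank z ≡ j → lookup f (identify x y z) ≡ lookup g z
          to-g {z} rz = trans (eq z) (cong (lookup g) (identify-other u v
            λ z≡u → j≢i (trans (sym rz) (trans (cong rank z≡u) ru))))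
      in x≢y (injective b (trans (sym (to-g rx)) (trans (cong (lookup f)
           (trans (identify-self x y) (sym (identify-other x y (x≢y ∘ sym))))) (to-g ry))))

  -- Two bijections that agree off one point have only one value left for that point.
  agree-off-point : ∀ {f g x} → Automorphism f → Automorphism g →
    (∀ {z} → z ≢ x → lookup f z ≡ lookup g z) → f ≡ g
  agree-off-point {f} {g} {x} a b off-x = lookup-ext λ z → decidable-stable (lookup f z ≟ lookup g z) λ f≢g →
    let z≡x = decidable-stable (z ≟ x) λ z≢x → f≢g (off-x z≢x)
        w   = lookup (inverse b) (lookup f z)
        w≢x = λ w≡x → f≢g (trans (sym (inverseʳ b _)) (cong (lookup g) (trans w≡x (sym z≡x))))
    in w≢x (trans (injective a (trans (off-x w≢x) (inverseʳ b _))) z≡x)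

  -- A composite gives back its level by `identify-level`, hence the pair of twins, then the
  -- automorphism off one point, and so the whole automorphism.
  twins-bound : ∀ h → length auts * length (twinLevels h) ≤ length ends
  twins-bound h = subst (_≤ length ends) (length-cartesianProductWith _,_ auts (twinLevels h))
    (injection⇒length≤ φ X ends
      (Unique.cartesianProduct⁺ auts-unique (Unique.filter⁺ twinLevel? (Unique.downFrom⁺ h))) φ∈ φ-inj)
    where
    X = cartesianProduct auts (twinLevels h)
    φ : SelfMap n × ℕ → SelfMap n
    φ (f , j) = tabulate (λ z → lookup f (fold j z))
    ∈X : ∀ {f j} → (f , j) ∈ X → Automorphism f × TwinLevel j
    ∈X p = let f∈ , j∈ = ∈-cartesianProduct⁻ auts (twinLevels h) p
           in ∈auts⁻ f∈ , proj₂ (∈-filter⁻ twinLevel? {xs = downFrom h} j∈)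
    φ∈ : ∀ {p} → p ∈ X → φ p ∈ ends
    φ∈ {f , j} p =
      let a , t = ∈X p
          x , y , tw , eq = fold-twin t
      in tabulate∈ends λ {z} {w} le → monotone a
           (subst₂ _⊑_ (sym (eq z)) (sym (eq w)) (identify-monotone tw le))
    φ-inj : ∀ {p q} → p ∈ X → q ∈ X → φ p ≡ φ q → p ≡ q
    φ-inj {f , j} {g , i} p q φ≡ =
      let a , t = ∈X p
          b , s = ∈X q
          x , y , tw , eq = fold-twin t
          _ , _ , tw′ , eq′ = fold-twin s
          level≡ = identify-level {f} {g} b tw tw′ λ z →
            trans (cong (lookup f) (sym (eq z))) (trans (tabulate-≡⇒ φ≡ z) (cong (lookup g) (eq′ z)))
          fold-off-x = λ {z} (z≢x : z ≢ x) → trans (eq z) (identify-other x y z≢x)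
      in cong₂ _,_ (agree-off-point a b λ {z} z≢x →
           trans (cong (lookup f) (sym (fold-off-x z≢x)))
             (trans (tabulate-≡⇒ φ≡ z) (cong (lookup g)
               (trans (cong (λ k → fold k z) (sym level≡)) (fold-off-x z≢x)))))
           level≡

  -- Pointwise stabilisers

  stabiliser : {Q : Fin n → Set} → (∀ x → Dec (Q x)) → List (SelfMap n)
  stabiliser Q? = filter (λ f → all? (λ x → Q? x →-dec (lookup f x ≟ x))) auts

  module _ {Q : Fin n → Set} (Q? : ∀ x → Dec (Q x)) where

    ∈stabiliser⁺ : ∀ {f} → Automorphism f → (∀ x → Q x → lookup f x ≡ x) → f ∈ stabiliser Q?
    ∈stabiliser⁺ a h = ∈-filter⁺ _ (∈auts⁺ a) h

    ∈stabiliser⁻ : ∀ {f} → f ∈ stabiliser Q? → Automorphism f × (∀ x → Q x → lookup f x ≡ x)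
    ∈stabiliser⁻ f∈ with ∈-filter⁻ _ {xs = auts} f∈
    ... | f∈auts , h = ∈auts⁻ f∈auts , h

    stabiliser-unique : Unique (stabiliser Q?)
    stabiliser-unique = Unique.filter⁺ _ auts-unique

    length-stabiliser>0 : 0 < length (stabiliser Q?)
    length-stabiliser>0 with stabiliser Q? | ∈stabiliser⁺ id-automorphism (λ x _ → lookup∘tabulate id x)
    ... | _ ∷ _ | _ = s≤s z≤n

    length-stabiliser≤1 : (∀ x → Q x) → length (stabiliser Q?) ≤ 1
    length-stabiliser≤1 all-Q = injection⇒length≤ id _ (idTable ∷ []) stabiliser-unique
      (λ f∈ → here (lookup-ext λ x → trans (proj₂ (∈stabiliser⁻ f∈) x (all-Q x)) (sym (lookup∘tabulate id x))))
      (λ _ _ eq → eq)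

-- Arithmetic of the telescoping product

telescope-step : ∀ a b e d t₀ u₀ t u t′ u′ → 0 < t → 0 < u →
  a * (t₀ * u) ≤ b * (t * u₀) → e * (t * u′) ≤ d * (t′ * u) → e * a * (t₀ * u′) ≤ d * b * (t′ * u₀)
telescope-step a b e d t₀ u₀ t u t′ u′ t>0 u>0 p q =
  -- The product of the two inequalities has the positive factor `t * u` on both sides.
  *-cancelʳ-≤ _ _ (t * u) {{>-nonZero (*-mono-≤ t>0 u>0)}} (begin
    e * a * (t₀ * u′) * (t * u)         ≡⟨ lhs e a t₀ u′ t u ⟩
    a * (t₀ * u) * (e * (t * u′))       ≤⟨ *-mono-≤ p q ⟩
    b * (t * u₀) * (d * (t′ * u))       ≡⟨ rhs b t u₀ d t′ u ⟩
    d * b * (t′ * u₀) * (t * u)         ∎)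
  where
  open ≤-Reasoning
  lhs : ∀ e a t₀ u′ t u → e * a * (t₀ * u′) * (t * u) ≡ a * (t₀ * u) * (e * (t * u′))
  lhs = solve-∀
  rhs : ∀ b t u₀ d t′ u → b * (t * u₀) * (d * (t′ * u)) ≡ d * b * (t′ * u₀) * (t * u)
  rhs = solve-∀

-- Bernoulli's inequality (8/7)^h ≥ 1 + h/7, cleared of denominators. Linear growth in `h` is enough
-- for the limit.
bernoulli : ∀ h → 7 ^ h * (7 + h) ≤ 7 * 8 ^ h
bernoulli zero    = ≤-refl
bernoulli (suc h) = begin
  7 * 7 ^ h * (7 + suc h)                 ≡⟨ split (7 ^ h) h ⟩
  7 * (7 ^ h * (7 + h)) + 7 ^ h * 7       ≤⟨ +-monoʳ-≤ (7 * (7 ^ h * (7 + h))) (*-monoʳ-≤ (7 ^ h) (m≤m+n 7 h)) ⟩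
  7 * (7 ^ h * (7 + h)) + 7 ^ h * (7 + h) ≡⟨ join (7 ^ h * (7 + h)) ⟩
  8 * (7 ^ h * (7 + h))                   ≤⟨ *-monoʳ-≤ 8 (bernoulli h) ⟩
  8 * (7 * 8 ^ h)                         ≡⟨ swap (8 ^ h) ⟩
  7 * (8 * 8 ^ h)                         ∎
  where
  open ≤-Reasoning
  split : ∀ p h → 7 * p * (7 + (1 + h)) ≡ 7 * (p * (7 + h)) + p * 7
  split = solve-∀
  join : ∀ x → 7 * x + x ≡ 8 * x
  join = solve-∀
  swap : ∀ x → 8 * (7 * x) ≡ 7 * (8 * x)
  swap = solve-∀

-- Used with p = 7^h, r = 8^h, `A` and `E` the numbers of automorphisms and endomorphisms, `G` the
-- order of the chain stabiliser and `S` the number of choices. Squaring A S ≤ E G brings in G²,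
-- after which p S² cancels.
square-and-cancel : ∀ p r h A E G S K² K^t → p * (7 + h) ≤ 7 * r → 0 < p → 0 < S →
  A * S ≤ E * G → r * (G * G) ≤ K² * (p * (S * S) * K^t) →
  (7 + h) * (A * A) ≤ 7 * (K² * K^t) * (E * E)
square-and-cancel p r h A E G S K² K^t bern p>0 S>0 AS≤EG rGG≤ =
  *-cancelʳ-≤ _ _ (p * (S * S)) {{>-nonZero (*-mono-≤ p>0 (*-mono-≤ S>0 S>0))}} (begin
    (7 + h) * (A * A) * (p * (S * S))           ≡⟨ e₁ h A p S ⟩
    p * (7 + h) * (A * S * (A * S))             ≤⟨ *-mono-≤ bern (*-mono-≤ AS≤EG AS≤EG) ⟩
    7 * r * (E * G * (E * G))                   ≡⟨ e₂ r E G ⟩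
    7 * (E * E) * (r * (G * G))                 ≤⟨ *-monoʳ-≤ (7 * (E * E)) rGG≤ ⟩
    7 * (E * E) * (K² * (p * (S * S) * K^t))    ≡⟨ e₃ E K² p S K^t ⟩
    7 * (K² * K^t) * (E * E) * (p * (S * S))    ∎)
  where
  open ≤-Reasoning
  e₁ : ∀ h A p S → (7 + h) * (A * A) * (p * (S * S)) ≡ p * (7 + h) * (A * S * (A * S))
  e₁ = solve-∀
  e₂ : ∀ r E G → 7 * r * (E * G * (E * G)) ≡ 7 * (E * E) * (r * (G * G))
  e₂ = solve-∀
  e₃ : ∀ E K p S k → 7 * (E * E) * (K * (p * (S * S) * k)) ≡ 7 * (K * k) * (E * E) * (p * (S * S))
  e₃ = solve-∀

length-levelOptions>0 : ∀ (c : A) xs → 0 < length (levelOptions c xs)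
length-levelOptions>0 c []       = s≤s z≤n
length-levelOptions>0 c (x ∷ xs) = s≤s z≤n

-- Abstract so that products with 10 ! are never unfolded in unary.
abstract
  κ : ℕ
  κ = 10 !

  q!≤κ : ∀ {q} → q ≤ 10 → q ! ≤ κ
  q!≤κ = !-mono-≤

  κ>0 : 0 < κ
  κ>0 = q!≤κ {0} z≤n

module BoundedWidth {n : ℕ} (P : FinPoset n) (width : WidthAtMost P 11) (x₀ : Fin n) where
  open FinPoset P using (_≼_)
  open Poset P
  open Automorphism

  -- A longest chain

  abstract
    maximalRank : ∃ λ h → ∃ (HasHeight h) × ¬ ∃ (HasHeight (suc h))
    maximalRank = boundedMaximum (λ k → any? (hasHeight? k)) (x₀ , tt) n (¬hasHeight-n ∘ proj₂)

  H : ℕ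
  H = proj₁ maximalRank

  rank≤H : ∀ x → rank x ≤ H
  rank≤H x = ≮⇒≥ λ H<rank →
    proj₂ (proj₂ maximalRank) (x , hasHeight-≤ H<rank (hasHeight-rank x))

  -- Numbered from the top, since `descend` leads downwards from a point of maximal rank; `chain`
  -- reverses the numbering so that index and rank coincide.
  descent : ℕ → Fin n
  descent zero    = proj₁ (proj₁ (proj₂ maximalRank))
  descent (suc i) = proj₁ (descend (descent i))

  rank-descent : ∀ i → rank (descent i) ≡ H ∸ i
  rank-descent zero = ≤-antisym (rank≤H _) (hasHeight⇒≤rank (proj₂ (proj₁ (proj₂ maximalRank))))
  rank-descent (suc i) = trans (proj₂ (proj₂ (descend (descent i))))
    (trans (cong pred (rank-descent i)) (pred[m∸n]≡m∸[1+n] H i))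

  descent-antitone : ∀ {i k} → i ≤ k → descent k ⊑ descent i
  descent-antitone {i} {k} i≤k with m≤n⇒m<n∨m≡n i≤k
  ... | inj₂ refl = ⊑-refl
  descent-antitone {i} {suc k} _ | inj₁ (s≤s i≤k) =
    ⊑-trans (proj₁ (proj₂ (descend (descent k)))) (descent-antitone i≤k)

  -- For j > H this is the top of the chain.
  chain : ℕ → Fin n
  chain j = descent (H ∸ j)

  rank-chain : ∀ {j} → j ≤ H → rank (chain j) ≡ j
  rank-chain {j} j≤H = trans (rank-descent (H ∸ j)) (m∸[m∸n]≡n j≤H)

  chain-monotone : ∀ {i j} → i ≤ j → chain i ⊑ chain j
  chain-monotone i≤j = descent-antitone (∸-monoʳ-≤ H i≤j)

  chain-suc-H : chain (suc H) ≡ chain H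
  chain-suc-H = cong descent (trans (m≤n⇒m∸n≡0 (n≤1+n H)) (sym (n∸n≡0 H)))

  inOthers? : ∀ j x → Dec (rank x ≡ j × x ≢ chain j)
  inOthers? j x = (rank x ℕ.≟ j) ×-dec ¬? (x ≟ chain j)

  -- Automorphisms that fix the chain permute this list, which has at most 10 entries because the
  -- chain element is left out of the level.
  others : ℕ → List (Fin n)
  others j = filter (inOthers? j) (allFin n)

  ∈others⁺ : ∀ {j x} → rank x ≡ j → x ≢ chain j → x ∈ others j
  ∈others⁺ {j} {x} rx x≢c = ∈-filter⁺ (inOthers? j) (∈-allFin x) (rx , x≢c)

  ∈others⁻ : ∀ {j x} → x ∈ others j → rank x ≡ j × x ≢ chain j
  ∈others⁻ {j} x∈ = proj₂ (∈-filter⁻ (inOthers? j) {xs = allFin n} x∈)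

  others-unique : ∀ j → Unique (others j)
  others-unique j = Unique.filter⁺ (inOthers? j) (Unique.allFin⁺ n)

  level-unique : ∀ j → Unique (chain j ∷ others j)
  level-unique j = All.tabulate (λ x∈ eq → proj₂ (∈others⁻ x∈) (sym eq)) ∷ others-unique j

  ∈level⇒rank : ∀ {j} → j ≤ H → ∀ {x} → x ∈ chain j ∷ others j → rank x ≡ j
  ∈level⇒rank j≤H (here refl) = rank-chain j≤H
  ∈level⇒rank j≤H (there x∈)  = proj₁ (∈others⁻ x∈)

  sameRank⇒length≤11 : ∀ {j} zs → Unique zs → (∀ {z} → z ∈ zs → rank z ≡ j) → length zs ≤ 11
  sameRank⇒length≤11 zs u same = antichain⇒length≤ width zs u λ x∈ y∈ →
    sameRank⇒¬⊑ (trans (same x∈) (sym (same y∈)))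

  length-others≤10 : ∀ {j} → j ≤ H → length (others j) ≤ 10
  length-others≤10 {j} j≤H = ≤-pred (sameRank⇒length≤11 _ (level-unique j) (∈level⇒rank j≤H))

  -- The ranks 0 to `H` split the points into antichains. Hence `H` tends to infinity with `n`.
  n≤[1+H]*11 : n ≤ suc H * 11
  n≤[1+H]*11 = subst₂ (λ a b → a ≤ b * 11) (length-tabulate {n = n} id) (length-upTo (suc H))
    (fibres⇒length≤ ℕ._≟_ rank 11 (allFin n) (upTo (suc H)) (Unique.allFin⁺ n)
      (λ {x} _ → ∈-upTo⁺ (s≤s (rank≤H x)))
      (λ j zs u h → sameRank⇒length≤11 zs u (proj₂ ∘ h)))

  chain⊎others : ∀ {j} x → rank x ≡ j → x ≡ chain j ⊎ x ∈ others j
  chain⊎others {j} x rx with x ≟ chain j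
  ... | yes eq = inj₁ eq
  ... | no ¬eq = inj₂ (∈others⁺ rx ¬eq)

  -- The stabilisers T_j and U_j

  -- The equation `x ≡ chain (rank x)` expresses that `x` lies on the chain. So `lowerStab 0` and
  -- `upperStab (suc H)` are both the chain stabiliser G, while `lowerStab (suc H)` and
  -- `upperStab 0` are trivial.
  FixBelow FixFrom : ℕ → Fin n → Set
  FixBelow j x = x ≡ chain (rank x) ⊎ rank x < j
  FixFrom  j x = x ≡ chain (rank x) ⊎ j ≤ rank x

  fixBelow? : ∀ j x → Dec (FixBelow j x)
  fixBelow? j x = (x ≟ chain (rank x)) ⊎-dec (rank x <? j)

  fixFrom? : ∀ j x → Dec (FixFrom j x)
  fixFrom? j x = (x ≟ chain (rank x)) ⊎-dec (j ≤? rank x)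

  lowerStab upperStab : ℕ → List (SelfMap n)
  lowerStab j = stabiliser (fixBelow? j)
  upperStab j = stabiliser (fixFrom? j)

  module _ {j : ℕ} (j≤H : j ≤ H) where

    fixesChain : ∀ {f} → (∀ x → x ≡ chain (rank x) → lookup f x ≡ x) → lookup f (chain j) ≡ chain j
    fixesChain h = h (chain j) (cong chain (sym (rank-chain j≤H)))

    restriction : SelfMap n → List (Fin n)
    restriction f = map (lookup f) (others j)

    maps-others : ∀ {f} → Automorphism f → lookup f (chain j) ≡ chain j →
      ∀ {x} → x ∈ others j → lookup f x ∈ others j
    maps-others {f} a fixes {x} x∈ = ∈others⁺ (trans (rank-automorphism a x) (proj₁ (∈others⁻ x∈)))
      λ eq → proj₂ (∈others⁻ x∈) (injective a (trans eq (sym fixes)))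

    map∈arrangements : (g : Fin n → Fin n) → (∀ {x y} → g x ≡ g y → x ≡ y) →
      (∀ {x} → x ∈ others j → g x ∈ others j) →
      map g (others j) ∈ arrangements _≟_ (length (others j)) (others j)
    map∈arrangements g inj maps =
      subst (λ k → map g (others j) ∈ arrangements _≟_ k (others j)) (length-map g (others j))
        (∈-arrangements _≟_ (map g (others j)) (others j) (Unique.map⁺ inj (others-unique j))
          λ y∈ → let x , x∈ , y≡ = ∈-map⁻ g y∈ in subst (_∈ others j) (sym y≡) (maps x∈))

    Pairs : List (SelfMap n × SelfMap n)
    Pairs = cartesianProduct (lowerStab j) (upperStab (suc j))

    pairs⁻ : ∀ {f g} → (f , g) ∈ Pairs →
      (Automorphism f × (∀ x → FixBelow j x → lookup f x ≡ x)) ×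
      (Automorphism g × (∀ x → FixFrom (suc j) x → lookup g x ≡ x))
    pairs⁻ p = let f∈ , g∈ = ∈-cartesianProduct⁻ (lowerStab j) (upperStab (suc j)) p
               in ∈stabiliser⁻ (fixBelow? j) f∈ , ∈stabiliser⁻ (fixFrom? (suc j)) g∈

    maps-others-lower : ∀ {f} → Automorphism f × (∀ x → FixBelow j x → lookup f x ≡ x) →
      ∀ {x} → x ∈ others j → lookup f x ∈ others j
    maps-others-lower {f} (a , h) = maps-others {f} a (fixesChain {f} λ x c → h x (inj₁ c))

    maps-others-upper : ∀ {f} → Automorphism f × (∀ x → FixFrom (suc j) x → lookup f x ≡ x) →
      ∀ {x} → x ∈ others j → lookup f x ∈ others j
    maps-others-upper {f} (a , h) = maps-others {f} a (fixesChain {f} λ x c → h x (inj₁ c))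

    -- Pairs with equal codes agree on L_j in both components, so translating one by the other adds
    -- L_j to the fixed points. This leads from T_j to T_{j+1} and from U_{j+1} to U_j, and each
    -- fibre of `φ` embeds in T_{j+1} × U_j.
    level-step : {B : Set} → DecidableEquality B → (φ : SelfMap n × SelfMap n → B) (codes : List B) →
      (∀ {p} → p ∈ Pairs → φ p ∈ codes) →
      (∀ {f g f₀ g₀} → (f , g) ∈ Pairs → (f₀ , g₀) ∈ Pairs → φ (f , g) ≡ φ (f₀ , g₀) →
        ∀ {x} → x ∈ others j → lookup f x ≡ lookup f₀ x × lookup g x ≡ lookup g₀ x) →
      length (lowerStab j) * length (upperStab (suc j)) ≤
        length codes * (length (lowerStab (suc j)) * length (upperStab j))
    level-step _≟B_ φ codes φ∈ agree =
      subst₂ (λ a b → a ≤ length codes * b)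
        (length-cartesianProductWith _,_ (lowerStab j) (upperStab (suc j)))
        (length-cartesianProductWith _,_ (lowerStab (suc j)) (upperStab j))
        (translates⇒length≤ _≟B_ φ Pairs codes (cartesianProduct (lowerStab (suc j)) (upperStab j))
          (Unique.cartesianProduct⁺ (stabiliser-unique (fixBelow? j)) (stabiliser-unique (fixFrom? (suc j))))
          φ∈ translate)
      where
      translate : ∀ {p₀} → p₀ ∈ Pairs → ∃ λ (ψ : SelfMap n × SelfMap n → SelfMap n × SelfMap n) →
        (∀ {p} → p ∈ Pairs → φ p ≡ φ p₀ → ψ p ∈ cartesianProduct (lowerStab (suc j)) (upperStab j)) ×
        (∀ {p p′} → p ∈ Pairs → p′ ∈ Pairs → φ p ≡ φ p₀ → φ p′ ≡ φ p₀ → ψ p ≡ ψ p′ → p ≡ p′)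
      translate {f₀ , g₀} p₀∈ = ψ , ψ∈ , λ _ _ _ _ eq →
          cong₂ _,_ (quotient-injective a₀ (cong proj₁ eq)) (quotient-injective b₀ (cong proj₂ eq))
        where
        a₀ = proj₁ (proj₁ (pairs⁻ p₀∈))
        b₀ = proj₁ (proj₂ (pairs⁻ p₀∈))
        fix₀ = proj₂ (proj₁ (pairs⁻ p₀∈))
        gix₀ = proj₂ (proj₂ (pairs⁻ p₀∈))
        ψ : SelfMap n × SelfMap n → SelfMap n × SelfMap n
        ψ (f , g) = quotient a₀ f , quotient b₀ g
        ψ∈ : ∀ {p} → p ∈ Pairs → φ p ≡ φ (f₀ , g₀) → ψ p ∈ cartesianProduct (lowerStab (suc j)) (upperStab j)
        ψ∈ {f , g} p∈ eq = ∈-cartesianProduct⁺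
          (∈stabiliser⁺ (fixBelow? (suc j)) (quotient-automorphism a₀ a)
            (λ x q → quotient-fixes a₀ {f} (lower x q)))
          (∈stabiliser⁺ (fixFrom? j) (quotient-automorphism b₀ b)
            (λ x q → quotient-fixes b₀ {g} (upper x q)))
          where
          a = proj₁ (proj₁ (pairs⁻ p∈))
          b = proj₁ (proj₂ (pairs⁻ p∈))
          fix = proj₂ (proj₁ (pairs⁻ p∈))
          gix = proj₂ (proj₂ (pairs⁻ p∈))
          both : ∀ {h h₀ : SelfMap n} {x} → lookup h x ≡ x → lookup h₀ x ≡ x → lookup h x ≡ lookup h₀ x
          both e e₀ = trans e (sym e₀)
          lower : ∀ x → FixBelow (suc j) x → lookup f x ≡ lookup f₀ x
          lower x (inj₁ c) = both {f} {f₀} (fix x (inj₁ c)) (fix₀ x (inj₁ c))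
          lower x (inj₂ (s≤s rx≤j)) with m≤n⇒m<n∨m≡n rx≤j
          ... | inj₁ rx<j = both {f} {f₀} (fix x (inj₂ rx<j)) (fix₀ x (inj₂ rx<j))
          ... | inj₂ refl with chain⊎others x refl
          ...   | inj₁ c  = both {f} {f₀} (fix x (inj₁ c)) (fix₀ x (inj₁ c))
          ...   | inj₂ x∈ = proj₁ (agree p∈ p₀∈ eq x∈)
          upper : ∀ x → FixFrom j x → lookup g x ≡ lookup g₀ x
          upper x (inj₁ c) = both {g} {g₀} (gix x (inj₁ c)) (gix₀ x (inj₁ c))
          upper x (inj₂ j≤rx) with m≤n⇒m<n∨m≡n j≤rx
          ... | inj₁ j<rx = both {g} {g₀} (gix x (inj₂ j<rx)) (gix₀ x (inj₂ j<rx))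
          ... | inj₂ refl with chain⊎others x refl
          ...   | inj₁ c  = both {g} {g₀} (gix x (inj₁ c)) (gix₀ x (inj₁ c))
          ...   | inj₂ x∈ = proj₂ (agree p∈ p₀∈ eq x∈)

    private
      q = length (others j)
      codes₁ = arrangements _≟_ q (others j)

    length-codes₁ : length codes₁ ≤ q !
    length-codes₁ = length-arrangements _≟_ q (others j) ≤-refl

    -- Both restrictions are recorded separately, at the price of a second factor `q !`. This serves
    -- the levels with twins and the top level.
    step-general : length (lowerStab j) * length (upperStab (suc j)) ≤
      (q ! * q !) * (length (lowerStab (suc j)) * length (upperStab j))
    step-general = ≤-trans
      (level-step (Product.≡-dec (List.≡-dec _≟_) (List.≡-dec _≟_)) φ (cartesianProduct codes₁ codes₁)
        (λ {p} → φ∈ {p})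
        (λ _ _ eq x∈ → map-≡⇒ _ _ (others j) (cong proj₁ eq) x∈ , map-≡⇒ _ _ (others j) (cong proj₂ eq) x∈))
      (*-monoˡ-≤ _ (≤-trans (≤-reflexive (length-cartesianProductWith _,_ codes₁ codes₁))
        (*-mono-≤ length-codes₁ length-codes₁)))
      where
      φ : SelfMap n × SelfMap n → List (Fin n) × List (Fin n)
      φ (f , g) = restriction f , restriction g
      φ∈ : ∀ {p} → p ∈ Pairs → φ p ∈ cartesianProduct codes₁ codes₁
      φ∈ {f , g} p∈ =
        let A , B = pairs⁻ p∈
        in ∈-cartesianProduct⁺
             (map∈arrangements (lookup f) (injective (proj₁ A)) (maps-others-lower {f} A))
             (map∈arrangements (lookup g) (injective (proj₁ B)) (maps-others-upper {g} B))

    -- If f (g x) = f₀ (g₀ x), then g x and g₀ x are related alike to the points below the level, because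
    -- f and f₀ fix these, and to the points above it, because g and g₀ fix those.
    step-no-twins : ¬ TwinLevel j → length (lowerStab j) * length (upperStab (suc j)) ≤
      (q !) * (length (lowerStab (suc j)) * length (upperStab j))
    step-no-twins ¬twin = ≤-trans
      (level-step (List.≡-dec _≟_) φ codes₁ (λ {p} → φ∈ {p}) agree)
      (*-monoˡ-≤ _ length-codes₁)
      where
      φ : SelfMap n × SelfMap n → List (Fin n)
      φ (f , g) = map (λ x → lookup f (lookup g x)) (others j)
      φ∈ : ∀ {p} → p ∈ Pairs → φ p ∈ codes₁
      φ∈ {f , g} p∈ =
        let A , B = pairs⁻ p∈
        in map∈arrangements (λ x → lookup f (lookup g x))
             (λ eq → injective (proj₁ B) (injective (proj₁ A) eq))
             (λ x∈ → maps-others-lower {f} A (maps-others-upper {g} B x∈))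
      agree : ∀ {f g f₀ g₀} → (f , g) ∈ Pairs → (f₀ , g₀) ∈ Pairs → φ (f , g) ≡ φ (f₀ , g₀) →
        ∀ {x} → x ∈ others j → lookup f x ≡ lookup f₀ x × lookup g x ≡ lookup g₀ x
      agree {f} {g} {f₀} {g₀} p∈ p₀∈ eq {x} x∈ = f≡f₀ , g≡g₀ x∈
        where
        a = proj₁ (proj₁ (pairs⁻ p∈))
        b = proj₁ (proj₂ (pairs⁻ p∈))
        fix = proj₂ (proj₁ (pairs⁻ p∈))
        gix = proj₂ (proj₂ (pairs⁻ p∈))
        a₀ = proj₁ (proj₁ (pairs⁻ p₀∈))
        b₀ = proj₁ (proj₂ (pairs⁻ p₀∈))
        fix₀ = proj₂ (proj₁ (pairs⁻ p₀∈))
        gix₀ = proj₂ (proj₂ (pairs⁻ p₀∈))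
        fg≡ : ∀ {y} → y ∈ others j → lookup f (lookup g y) ≡ lookup f₀ (lookup g₀ y)
        fg≡ = map-≡⇒ _ _ (others j) eq
        lower≼ : ∀ {h} → Automorphism h → ∀ z → lookup h z ≡ z → ∀ u → (z ≼ lookup h u) ≡ (z ≼ u)
        lower≼ {h} c z hz u = trans (cong (_≼ lookup h u) (sym hz)) (automorphism-≼ c z u)
        upper≼ : ∀ {h} → Automorphism h → ∀ z → lookup h z ≡ z → ∀ u → (lookup h u ≼ z) ≡ (u ≼ z)
        upper≼ {h} c z hz u = trans (cong (lookup h u ≼_) (sym hz)) (automorphism-≼ c u z)
        g≡g₀ : ∀ {y} → y ∈ others j → lookup g y ≡ lookup g₀ y
        g≡g₀ {y} y∈ = decidable-stable (lookup g y ≟ lookup g₀ y) λ u≢u₀ →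
          ¬twin (lookup g y , lookup g₀ y ,
            ( trans (rank-automorphism b y) (proj₁ (∈others⁻ y∈))
            , trans (rank-automorphism b₀ y) (proj₁ (∈others⁻ y∈))
            , u≢u₀) ,
            (λ z rz<j → trans (sym (lower≼ a z (fix z (inj₂ rz<j)) _))
               (trans (cong (z ≼_) (fg≡ y∈)) (lower≼ a₀ z (fix₀ z (inj₂ rz<j)) _))) ,
            (λ z j<rz → trans (upper≼ b z (gix z (inj₂ j<rz)) y)
               (sym (upper≼ b₀ z (gix₀ z (inj₂ j<rz)) y))))
        -- Write x = g w. Since g₀ w = g w, equality of the composites at `w` compares `f` and `f₀`
        -- at `x`.
        w = lookup (inverse b) x
        w∈ : w ∈ others j
        w∈ = ∈others⁺ (trans (rank-automorphism (inverse-automorphism b) x) (proj₁ (∈others⁻ x∈)))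
          λ w≡c → proj₂ (∈others⁻ x∈) (trans (sym (inverseʳ b x)) (trans (cong (lookup g) w≡c)
            (fixesChain {g} λ z c → gix z (inj₁ c))))
        f≡f₀ : lookup f x ≡ lookup f₀ x
        f≡f₀ = trans (cong (lookup f) (sym (inverseʳ b x))) (trans (fg≡ w∈)
          (cong (lookup f₀) (trans (sym (g≡g₀ w∈)) (inverseʳ b x))))

  -- Maps onto the chain

  -- One subset for each level below j, highest level first.
  choices : ℕ → List (List (List (Fin n)))
  choices zero    = [] ∷ []
  choices (suc j) = cartesianProductWith _∷_ (levelOptions (chain j) (others j)) (choices j)

  choices-unique : ∀ j → Unique (choices j)
  choices-unique zero    = [] ∷ []
  choices-unique (suc j) = Unique.cartesianProductWith⁺ _∷_ ∷-injective
    (levelOptions-unique (chain j) (others j) (level-unique j)) (choices-unique j)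

  ∈choices-suc : ∀ {j o} → o ∈ choices (suc j) → ∃ λ l → ∃ λ o′ →
    l ∈ levelOptions (chain j) (others j) × o′ ∈ choices j × o ≡ l ∷ o′
  ∈choices-suc {j} = ∈-cartesianProductWith⁻ _∷_ (levelOptions (chain j) (others j)) (choices j)

  option-rank : ∀ {j l} → j ≤ H → l ∈ levelOptions (chain j) (others j) → ∀ {x} → x ∈ l → rank x ≡ j
  option-rank {j} j≤H l∈ x∈ = ∈level⇒rank j≤H (levelOptions-⊆ (chain j) (others j) l∈ x∈)

  choices-rank< : ∀ {j o} → j ≤ H → o ∈ choices j → ∀ {x} → x ∈ concat o → rank x < j
  choices-rank< {zero} _ (here refl) ()
  choices-rank< {suc j} j<H o∈ x∈ with ∈choices-suc o∈
  ... | l , o′ , l∈ , o′∈ , refl with ∈-++⁻ l x∈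
  ... | inj₁ x∈l  = s≤s (≤-reflexive (option-rank (<⇒≤ j<H) l∈ x∈l))
  ... | inj₂ x∈o′ = m<n⇒m<1+n (choices-rank< (<⇒≤ j<H) o′∈ x∈o′)

  -- Distinct levels are disjoint, so the union of the chosen sets determines each of them. Only
  -- points of rank below `j` are compared; with j = H these are the points where the map shows the
  -- choice.
  choices-ext : ∀ {j o o′} → j ≤ H → o ∈ choices j → o′ ∈ choices j →
    (∀ {x} → rank x < j → x ∈ concat o → x ∈ concat o′) →
    (∀ {x} → rank x < j → x ∈ concat o′ → x ∈ concat o) → o ≡ o′
  choices-ext {zero} _ (here refl) (here refl) _ _ = refl
  choices-ext {suc j} j<H o∈ o′∈ to from with ∈choices-suc o∈ | ∈choices-suc o′∈
  ... | l , p , l∈ , p∈ , refl | l′ , p′ , l′∈ , p′∈ , refl =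
    cong₂ _∷_
      (levelOptions-ext (chain j) (others j) (level-unique j) l∈ l′∈
        (top {l} {l′} {p} {p′} l∈ p′∈ to) (top {l′} {l} {p′} {p} l′∈ p∈ from))
      (choices-ext j≤H p∈ p′∈ (rest {l} {l′} {p} {p′} l′∈ to) (rest {l′} {l} {p′} {p} l∈ from))
    where
    j≤H = <⇒≤ j<H
    top : ∀ {l l′ p p′} → l ∈ levelOptions (chain j) (others j) → p′ ∈ choices j →
      (∀ {x} → rank x < suc j → x ∈ l ++ concat p → x ∈ l′ ++ concat p′) → ∀ {x} → x ∈ l → x ∈ l′
    top {l} {l′} l∈ p′∈ h x∈ with ∈-++⁻ l′ (h (s≤s (≤-reflexive (option-rank j≤H l∈ x∈))) (∈-++⁺ˡ x∈))
    ... | inj₁ q = q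
    ... | inj₂ q = contradiction (choices-rank< j≤H p′∈ q) (<-irrefl (option-rank j≤H l∈ x∈))
    rest : ∀ {l l′ p p′} → l′ ∈ levelOptions (chain j) (others j) →
      (∀ {x} → rank x < suc j → x ∈ l ++ concat p → x ∈ l′ ++ concat p′) →
      ∀ {x} → rank x < j → x ∈ concat p → x ∈ concat p′
    rest {l} {l′} l′∈ h rx<j x∈ with ∈-++⁻ l′ (h (m<n⇒m<1+n rx<j) (∈-++⁺ʳ l x∈))
    ... | inj₂ q = q
    ... | inj₁ q = contradiction rx<j (<-irrefl (option-rank j≤H l′∈ q))

  -- A chosen point of rank `k` is sent to `chain k`, so in the first case `chain k` is a value of
  -- the map onto the chain.
  choices-hit : ∀ {j k o} → j ≤ H → o ∈ choices j → k < j →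
    (∃ λ x → rank x ≡ k × x ∈ concat o) ⊎ others k ≡ []
  choices-hit {suc j} j<H o∈ (s≤s k≤j) with ∈choices-suc o∈ | m≤n⇒m<n∨m≡n k≤j
  choices-hit {suc j} {k} j<H o∈ _ | l , p , l∈ , p∈ , refl | inj₁ k<j
    with choices-hit (<⇒≤ j<H) p∈ k<j
  ... | inj₁ (x , rx , x∈) = inj₁ (x , rx , ∈-++⁺ʳ l x∈)
  ... | inj₂ e = inj₂ e
  choices-hit {suc j} j<H o∈ _ | l , p , l∈ , p∈ , refl | inj₂ refl
    with levelOptions-inhabited (chain j) (others j) l∈
  ... | inj₁ (x , x∈) = inj₁ (x , option-rank (<⇒≤ j<H) l∈ x∈ , ∈-++⁺ˡ x∈)
  ... | inj₂ e = inj₂ e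

  ontoChain : List (List (Fin n)) → Fin n → Fin n
  ontoChain o x with x ∈? concat o
  ... | yes _ = chain (rank x)
  ... | no _  = chain (suc (rank x))

  ontoChain-∈ : ∀ o {x} → x ∈ concat o → ontoChain o x ≡ chain (rank x)
  ontoChain-∈ o {x} x∈ with x ∈? concat o
  ... | yes _ = refl
  ... | no x∉ = contradiction x∈ x∉

  ontoChain-∉ : ∀ o {x} → x ∉ concat o → ontoChain o x ≡ chain (suc (rank x))
  ontoChain-∉ o {x} x∉ with x ∈? concat o
  ... | yes x∈ = contradiction x∈ x∉
  ... | no _ = refl

  ontoChain-lower : ∀ o x → chain (rank x) ⊑ ontoChain o x
  ontoChain-lower o x with x ∈? concat o
  ... | yes _ = ⊑-refl
  ... | no _  = chain-monotone (n≤1+n _)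

  ontoChain-upper : ∀ o x → ontoChain o x ⊑ chain (suc (rank x))
  ontoChain-upper o x with x ∈? concat o
  ... | yes _ = chain-monotone (n≤1+n _)
  ... | no _  = ⊑-refl

  -- If `x` lies strictly below `y`, with ranks i < j, then the value at `x` is at most c_{i+1}, the
  -- value at `y` is at least c_j, and i + 1 ≤ j.
  ontoChain-monotone : ∀ o → Monotone (ontoChain o)
  ontoChain-monotone o {x} {y} x⊑y with x ≟ y
  ... | yes refl = ⊑-refl
  ... | no x≢y = ⊑-trans (ontoChain-upper o x)
    (⊑-trans (chain-monotone (≺⇒rank< (x⊑y , x≢y))) (ontoChain-lower o y))

  -- Whichever branch applies, the value is the same, because `chain` is constant from `H` on. So
  -- the top of the chain is always hit.
  ontoChain-top : ∀ o → ontoChain o (chain H) ≡ chain H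
  ontoChain-top o with chain H ∈? concat o
  ... | yes _ = cong chain (rank-chain ≤-refl)
  ... | no _  = trans (cong (chain ∘ suc) (rank-chain ≤-refl)) chain-suc-H

  -- Below the top level a chosen point keeps its rank and any other point gains one, so the ranks
  -- of the values reveal the choice.
  ontoChain-rank⇒⊆ : ∀ o o′ {x} → rank x < H → rank (ontoChain o x) ≡ rank (ontoChain o′ x) →
    x ∈ concat o → x ∈ concat o′
  ontoChain-rank⇒⊆ o o′ {x} rx<H eq x∈ = decidable-stable (x ∈? concat o′) λ x∉ →
    1+n≢n (sym (trans (sym (rank-chain (<⇒≤ rx<H))) (trans (cong rank (sym (ontoChain-∈ o x∈)))
      (trans eq (trans (cong rank (ontoChain-∉ o′ x∉)) (rank-chain rx<H))))))

  -- In a fibre of `φ` the choice is constant and the automorphisms agree on the chain, so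
  -- translation embeds the fibre in G, that is, in `lowerStab 0`.
  retractions-bound : length auts * length (choices H) ≤ length ends * length (lowerStab 0)
  retractions-bound = subst (_≤ length ends * length (lowerStab 0))
    (length-cartesianProductWith _,_ auts (choices H))
    (translates⇒length≤ (≡-dec _≟_) φ X ends (lowerStab 0)
      (Unique.cartesianProduct⁺ auts-unique (choices-unique H)) φ∈ translate)
    where
    X = cartesianProduct auts (choices H)
    φ : SelfMap n × List (List (Fin n)) → SelfMap n
    φ (f , o) = tabulate (λ x → lookup f (ontoChain o x))
    ∈X : ∀ {f o} → (f , o) ∈ X → Automorphism f × o ∈ choices H
    ∈X p = let f∈ , o∈ = ∈-cartesianProduct⁻ auts (choices H) p in ∈auts⁻ f∈ , o∈
    φ∈ : ∀ {p} → p ∈ X → φ p ∈ ends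
    φ∈ {f , o} p = tabulate∈ends λ le → monotone (proj₁ (∈X p)) (ontoChain-monotone o le)

    φ-determines-choice : ∀ {f o f₀ o₀} → (f , o) ∈ X → (f₀ , o₀) ∈ X → φ (f , o) ≡ φ (f₀ , o₀) → o ≡ o₀
    φ-determines-choice {f} {o} {f₀} {o₀} p p₀ eq = choices-ext ≤-refl (proj₂ (∈X p)) (proj₂ (∈X p₀))
      (λ rx<H → ontoChain-rank⇒⊆ o o₀ rx<H (same-rank _))
      (λ rx<H → ontoChain-rank⇒⊆ o₀ o rx<H (sym (same-rank _)))
      where
      same-rank : ∀ x → rank (ontoChain o x) ≡ rank (ontoChain o₀ x)
      same-rank x = trans (sym (rank-automorphism (proj₁ (∈X p)) _))
        (trans (cong rank (tabulate-≡⇒ eq x)) (rank-automorphism (proj₁ (∈X p₀)) _))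

    agree-on-chain : ∀ {f o f₀} → Automorphism f → Automorphism f₀ → o ∈ choices H →
      (∀ x → lookup f (ontoChain o x) ≡ lookup f₀ (ontoChain o x)) →
      ∀ {k} → k ≤ H → lookup f (chain k) ≡ lookup f₀ (chain k)
    agree-on-chain {f} {o} {f₀} a a₀ o∈ eq {k} k≤H with m≤n⇒m<n∨m≡n k≤H
    ... | inj₂ refl = subst (λ z → lookup f z ≡ lookup f₀ z) (ontoChain-top o) (eq (chain H))
    ... | inj₁ k<H with choices-hit ≤-refl o∈ k<H
    ...   | inj₁ (x , refl , x∈) = subst (λ z → lookup f z ≡ lookup f₀ z) (ontoChain-∈ o x∈) (eq x)
    -- On a one-point level the chain element may be missed, but rank preservation forces every
    -- automorphism to fix it.
    ...   | inj₂ none = trans (fixed a) (sym (fixed a₀))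
      where
      fixed : ∀ {g} → Automorphism g → lookup g (chain k) ≡ chain k
      fixed {g} b with chain⊎others (lookup g (chain k)) (trans (rank-automorphism b _) (rank-chain k≤H))
      ... | inj₁ e = e
      ... | inj₂ x∈ with () ← subst (lookup g (chain k) ∈_) none x∈

    translate : ∀ {p₀} → p₀ ∈ X → ∃ λ (ψ : SelfMap n × List (List (Fin n)) → SelfMap n) →
      (∀ {p} → p ∈ X → φ p ≡ φ p₀ → ψ p ∈ lowerStab 0) ×
      (∀ {p p′} → p ∈ X → p′ ∈ X → φ p ≡ φ p₀ → φ p′ ≡ φ p₀ → ψ p ≡ ψ p′ → p ≡ p′)
    translate {f₀ , o₀} p₀∈ = quotient a₀ ∘ proj₁ , ψ∈ , λ p∈ p′∈ eq eq′ q≡ →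
        cong₂ _,_ (quotient-injective a₀ q≡)
          (trans (φ-determines-choice p∈ p₀∈ eq) (sym (φ-determines-choice p′∈ p₀∈ eq′)))
      where
      a₀ : Automorphism f₀
      a₀ = proj₁ (∈X p₀∈)
      ψ∈ : ∀ {p} → p ∈ X → φ p ≡ φ (f₀ , o₀) → quotient a₀ (proj₁ p) ∈ lowerStab 0
      ψ∈ {f , o} p∈ eq = ∈stabiliser⁺ (fixBelow? 0) (quotient-automorphism a₀ a) fixes
        where
        a = proj₁ (∈X p∈)
        agree : ∀ x → lookup f (ontoChain o x) ≡ lookup f₀ (ontoChain o x)
        agree x = trans (tabulate-≡⇒ eq x)
          (cong (λ c → lookup f₀ (ontoChain c x)) (sym (φ-determines-choice p∈ p₀∈ eq)))
        fixes : ∀ x → FixBelow 0 x → lookup (quotient a₀ f) x ≡ x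
        fixes x (inj₁ c) = quotient-fixes a₀ {f} (subst (λ z → lookup f z ≡ lookup f₀ z) (sym c)
          (agree-on-chain {f} {o} {f₀} a a₀ (proj₂ (∈X p∈)) agree (rank≤H x)))

  -- Telescoping over the levels

  length-choices-suc : ∀ j → length (choices (suc j)) ≡ optionCount (length (others j)) * length (choices j)
  length-choices-suc j = trans (length-cartesianProductWith _∷_ (levelOptions (chain j) (others j)) (choices j))
    (cong (_* length (choices j)) (length-levelOptions (chain j) (others j)))

  T# U# : ℕ → ℕ
  T# j = length (lowerStab j)
  U# j = length (upperStab j)

  -- Bounds the second factor `q !` that `step-general` has over `step-no-twins`.
  cost : ℕ → ℕ
  cost j with twinLevel? j
  ... | yes _ = κ
  ... | no _  = 1

  twinLevels-suc : ∀ j → κ ^ length (twinLevels (suc j)) ≡ cost j * κ ^ length (twinLevels j)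
  twinLevels-suc j with twinLevel? j
  ... | yes _ = refl
  ... | no _  = sym (+-identityʳ _)

  step : ∀ {j} → j ≤ H → 8 * (T# j * U# (suc j)) ≤
    7 * (optionCount (length (others j)) * optionCount (length (others j))) * cost j * (T# (suc j) * U# j)
  step {j} j≤H with twinLevel? j
  ... | no ¬t = begin
    8 * (T# j * U# (suc j))           ≤⟨ *-monoʳ-≤ 8 (step-no-twins j≤H ¬t) ⟩
    8 * (q ! * X)                     ≡⟨ *-assoc 8 (q !) X ⟨
    8 * q ! * X                       ≤⟨ *-monoˡ-≤ X (8q!≤7optionCount² q≤10) ⟩
    7 * (s * s) * X                   ≡⟨ cong (_* X) (*-identityʳ (7 * (s * s))) ⟨
    7 * (s * s) * 1 * X               ∎
    where
    open ≤-Reasoning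
    q = length (others j)
    s = optionCount q
    X = T# (suc j) * U# j
    q≤10 = length-others≤10 j≤H
  ... | yes _ = begin
    8 * (T# j * U# (suc j))           ≤⟨ *-monoʳ-≤ 8 (step-general j≤H) ⟩
    8 * (q ! * q ! * X)               ≡⟨ trans (sym (*-assoc 8 (q ! * q !) X)) (cong (_* X) (sym (*-assoc 8 (q !) (q !)))) ⟩
    8 * q ! * q ! * X                 ≤⟨ *-monoˡ-≤ X (*-mono-≤ (8q!≤7optionCount² q≤10) (q!≤κ q≤10)) ⟩
    7 * (s * s) * κ * X               ∎
    where
    open ≤-Reasoning
    q = length (others j)
    s = optionCount q
    X = T# (suc j) * U# j
    q≤10 = length-others≤10 j≤H

  -- The quotient T_0 U_j / (T_j U_0) is multiplied at each step by T_j U_{j+1} / (T_{j+1} U_j),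
  -- which `step` bounds. The squared option counts accumulate to the square of the number of
  -- choices.
  telescope : ∀ j → j ≤ H → 8 ^ j * (T# 0 * U# j) ≤
    (7 ^ j * (length (choices j) * length (choices j)) * κ ^ length (twinLevels j)) * (T# j * U# 0)
  telescope zero _ = ≤-refl
  telescope (suc j) j<H = begin
    8 * 8 ^ j * (T# 0 * U# (suc j))
      ≤⟨ telescope-step (8 ^ j) (7 ^ j * (S * S) * K^t) 8 (7 * (s * s) * cost j)
           (T# 0) (U# 0) (T# j) (U# j) (T# (suc j)) (U# (suc j))
           (length-stabiliser>0 (fixBelow? j)) (length-stabiliser>0 (fixFrom? j))
           (telescope j (<⇒≤ j<H)) (step (<⇒≤ j<H)) ⟩
    7 * (s * s) * cost j * (7 ^ j * (S * S) * K^t) * (T# (suc j) * U# 0)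
      ≡⟨ cong (_* (T# (suc j) * U# 0)) (rearrange s (cost j) (7 ^ j) S K^t) ⟩
    7 * 7 ^ j * (s * S * (s * S)) * (cost j * K^t) * (T# (suc j) * U# 0)
      ≡⟨ cong₂ (λ a b → 7 * 7 ^ j * (a * a) * b * (T# (suc j) * U# 0))
           (sym (length-choices-suc j)) (sym (twinLevels-suc j)) ⟩
    7 ^ suc j * (length (choices (suc j)) * length (choices (suc j)))
      * κ ^ length (twinLevels (suc j)) * (T# (suc j) * U# 0) ∎
    where
    open ≤-Reasoning
    S = length (choices j)
    s = optionCount (length (others j))
    K^t = κ ^ length (twinLevels j)
    rearrange : ∀ s c p S k → 7 * (s * s) * c * (p * (S * S) * k) ≡ 7 * p * (s * S * (s * S)) * (c * k)
    rearrange = solve-∀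

  -- No rank exceeds `H`, so both stabilisers fix just the chain by definition.
  T#0≤U#[1+H] : T# 0 ≤ U# (suc H)
  T#0≤U#[1+H] = injection⇒length≤ id (lowerStab 0) (upperStab (suc H)) (stabiliser-unique (fixBelow? 0))
    (λ {f} f∈ → let a , h = ∈stabiliser⁻ (fixBelow? 0) f∈ in ∈stabiliser⁺ (fixFrom? (suc H)) a
      λ { x (inj₁ c) → h x (inj₁ c) ; x (inj₂ H<rx) → contradiction (rank≤H x) (<⇒≱ H<rx) })
    (λ _ _ eq → eq)

  T#[1+H]≤1 : T# (suc H) ≤ 1
  T#[1+H]≤1 = length-stabiliser≤1 (fixBelow? (suc H)) λ x → inj₂ (s≤s (rank≤H x))

  U#0≤1 : U# 0 ≤ 1
  U#0≤1 = length-stabiliser≤1 (fixFrom? 0) λ x → inj₂ z≤n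

  -- Through all levels the left side becomes T_0 U_{H+1}, at least |G|², and the last factor
  -- T_{H+1} U_0 is at most 1. The top level offers no choices against its factorials and costs
  -- `κ * κ`.
  chainStabiliser-bound : 8 ^ H * (T# 0 * T# 0) ≤
    κ * κ * (7 ^ H * (length (choices H) * length (choices H)) * κ ^ length (twinLevels H))
  chainStabiliser-bound = begin
    8 ^ H * (T# 0 * T# 0)               ≤⟨ *-monoʳ-≤ (8 ^ H) (*-monoʳ-≤ (T# 0) T#0≤U#[1+H]) ⟩
    8 ^ H * (T# 0 * U# (suc H))         ≡⟨ cong (_* (T# 0 * U# (suc H))) (*-identityˡ (8 ^ H)) ⟨
    1 * 8 ^ H * (T# 0 * U# (suc H))     ≤⟨ telescope-step (8 ^ H) D 1 (κ * κ)
                                             (T# 0) (U# 0) (T# H) (U# H) (T# (suc H)) (U# (suc H))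
                                             (length-stabiliser>0 (fixBelow? H)) (length-stabiliser>0 (fixFrom? H))
                                             (telescope H ≤-refl) top ⟩
    κ * κ * D * (T# (suc H) * U# 0)     ≤⟨ *-monoʳ-≤ (κ * κ * D) (*-mono-≤ T#[1+H]≤1 U#0≤1) ⟩
    κ * κ * D * 1                       ≡⟨ *-identityʳ _ ⟩
    κ * κ * D                           ∎
    where
    open ≤-Reasoning
    D = 7 ^ H * (length (choices H) * length (choices H)) * κ ^ length (twinLevels H)
    top!≤κ = q!≤κ (length-others≤10 ≤-refl)
    top : 1 * (T# H * U# (suc H)) ≤ κ * κ * (T# (suc H) * U# H)
    top = ≤-trans (≤-reflexive (*-identityˡ _)) (≤-trans (step-general ≤-refl)
      (*-monoˡ-≤ (T# (suc H) * U# H) (*-mono-≤ top!≤κ top!≤κ)))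

  length-choices>0 : ∀ j → 0 < length (choices j)
  length-choices>0 zero    = s≤s z≤n
  length-choices>0 (suc j) = subst (0 <_) (sym (length-cartesianProductWith _∷_ (levelOptions (chain j) (others j)) (choices j)))
    (*-mono-≤ (length-levelOptions>0 (chain j) (others j)) (length-choices>0 j))

  squares-bound : (7 + H) * (length auts * length auts) ≤
    7 * (κ * κ * κ ^ length (twinLevels H)) * (length ends * length ends)
  squares-bound = square-and-cancel (7 ^ H) (8 ^ H) H (length auts) (length ends) (T# 0) (length (choices H)) (κ * κ)
    (κ ^ length (twinLevels H)) (bernoulli H) (m^n>0 7 H) (length-choices>0 H)
    retractions-bound chainStabiliser-bound

-- The limit

threshold : ℕ → ℕ
-- Eleven times the constant `D` of the next proof, plus one: with `n≤[1+H]*11` this gives D < 1 +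
-- H. The `suc` also makes the poset nonempty.
threshold q = suc (7 * (κ * κ * κ ^ q) * (q * q) * 11)

q*auts<ends : ∀ q n → threshold q ≤ n → (P : FinPoset n) → WidthAtMost P 11 → q * numAut P < numEnd P
q*auts<ends q (suc n) (s≤s large) P width =
  subst₂ (λ a e → q * a < e) (sym numAut≡length-auts) (sym numEnd≡length-ends) bound
  where
  open Poset P
  open BoundedWidth P width Fin.zero
  #A = length auts
  #E = length ends
  t = length (twinLevels H)
  K D : ℕ
  K = κ * κ * κ ^ q
  D = 7 * K * (q * q)
  #A>0 : 0 < #A
  #A>0 with auts | ∈auts⁺ id-automorphism
  ... | _ ∷ _ | _ = s≤s z≤n
  many-twins : q < t → q * #A < #E
  many-twins q<t = begin-strict
    q * #A       <⟨ *-monoˡ-< #A {{>-nonZero #A>0}} q<t ⟩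
    t * #A       ≡⟨ *-comm t #A ⟩
    #A * t       ≤⟨ twins-bound H ⟩
    #E           ∎
    where open ≤-Reasoning
  few-twins : t ≤ q → q * #A < #E
  -- If `#E ≤ q * #A`, then `squares-bound` yields 7 + H ≤ D after cancelling the square of `#A`,
  -- against the choice of `threshold`.
  few-twins t≤q = ≰⇒> λ E≤qA → <⇒≱ D<7+H (*-cancelʳ-≤ (7 + H) D (#A * #A) {{>-nonZero (*-mono-≤ #A>0 #A>0)}} (begin
    (7 + H) * (#A * #A)                              ≤⟨ squares-bound ⟩
    7 * (κ * κ * κ ^ t) * (#E * #E)                  ≤⟨ *-mono-≤ (*-monoʳ-≤ 7 (*-monoʳ-≤ (κ * κ) (^-monoʳ-≤ κ {{>-nonZero κ>0}} t≤q)))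
                                                        (*-mono-≤ E≤qA E≤qA) ⟩
    7 * K * (q * #A * (q * #A))                      ≡⟨ regroup K q #A ⟩
    D * (#A * #A)                                    ∎))
    where
    open ≤-Reasoning
    regroup : ∀ K q a → 7 * K * (q * a * (q * a)) ≡ 7 * K * (q * q) * (a * a)
    regroup = solve-∀
    D<7+H : D < 7 + H
    D<7+H = <-≤-trans (*-cancelʳ-< 11 D (suc H) (≤-trans (s≤s large) n≤[1+H]*11)) (+-monoˡ-≤ H (s≤s z≤n))
  bound : q * #A < #E
  bound with q <? t
  ... | yes q<t = many-twins q<t
  ... | no q≮t  = few-twins (≮⇒≥ q≮t)

-- Take for `q` the denominator of `ε`: the numerator is at least 1, so ε ≥ 1/q.
∃below : ∀ (ε : ℚ) → Positive ε → ∃ λ q → ∀ a e → q * a < e → (+ a) ℚ./ 1 ℚ.< ε ℚ.* ((+ e) ℚ./ 1)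
∃below ε@(mkℚ (+ suc p) d _) _ = suc d , λ a e qa<e → ℚ.toℚᵘ-cancel-< (begin-strict
  ℚ.toℚᵘ ((+ a) ℚ./ 1)                    ≃⟨ ℚ.toℚᵘ-fromℚᵘ (mkℚᵘ (+ a) 0) ⟩
  mkℚᵘ (+ a) 0                            <⟨ *<* (ints a e qa<e) ⟩
  ℚ.toℚᵘ ε ℚᵘ.* mkℚᵘ (+ e) 0              ≃⟨ ℚᵘ.*-congˡ {ℚ.toℚᵘ ε} (ℚ.toℚᵘ-fromℚᵘ (mkℚᵘ (+ e) 0)) ⟨
  ℚ.toℚᵘ ε ℚᵘ.* ℚ.toℚᵘ ((+ e) ℚ./ 1)      ≃⟨ ℚ.toℚᵘ-homo-* ε ((+ e) ℚ./ 1) ⟨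
  ℚ.toℚᵘ (ε ℚ.* ((+ e) ℚ./ 1))            ∎)
  where
  open ℚᵘ.≤-Reasoning
  ints : ∀ a e → suc d * a < e → (+ a) ℤ.* (+ (suc d * 1)) ℤ.< ((+ suc p) ℤ.* (+ e)) ℤ.* (+ 1)
  ints a e qa<e = subst₂ ℤ._<_ (ℤ.pos-* a (suc d * 1))
    (trans (ℤ.pos-* (suc p * e) 1) (cong (ℤ._* (+ 1)) (ℤ.pos-* (suc p) e)))
    (ℤ.+<+ (≤-trans (subst (_< e) comm qa<e) (≤-trans (m≤m+n e (p * e)) (≤-reflexive (sym (*-identityʳ (suc p * e)))))))
    where
    comm : suc d * a ≡ a * (suc d * 1)
    comm = trans (*-comm (suc d) a) (cong (a *_) (sym (*-identityʳ (suc d))))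

theorem7p11 : ∀ (ε : ℚ) → Positive ε → ∃[ N ] ∀ (n : ℕ) → N ≤ n → (P : FinPoset n) → WidthAtMost P 11 →
    (+ numAut P) ℚ./ 1 ℚ.< ε ℚ.* ((+ numEnd P) ℚ./ 1)
theorem7p11 ε ε>0 = let q , below = ∃below ε ε>0 in
  threshold q , λ n large P width → below (numAut P) (numEnd P) (q*auts<ends q n large P width)
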